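{- Neither a bound on the number of columns alone nor a bound on the number of paths per grid-edge alone guarantees bounded mim-width of VPG graphs. More precisely: (a) grid graphs admit a VPG representation $(\mathcal{G},\mathcal{P})$ such that each grid-edge in $\mathcal{G}$ belongs to at most one path in $\mathcal{P}$, but grid graphs do not have bounded mim-width; (b) split graphs admit a VPG representation $(\mathcal{G},\mathcal{P})$ such that $\mathcal{G}$ contains at most $4$ columns, but split graphs do not have bounded mim-width.
   Context: All graphs are finite and simple. A split graph is a graph whose vertex set can be partitioned into a clique and an independent set. A grid graph is the graph with vertex set $\{1,\dots,a\}\times\{1,\dots,b\}$, for some positive integers $a,b$, in which two vertices are adjacent if and only if they are at Euclidean distance $1$. The vertical lines of a rectangular grid $\mathcal{G}$ are its columns. A path on a grid is a simple path made of grid-edges (at least one). A graph $G$ is VPG if there is a collection $\mathcal{P}$ of paths on a grid $\mathcal{G}$, in one-to-one correspondence with $V(G)$, such that two distinct vertices are adjacent in $G$ if and only if the corresponding paths share at least one grid-point; $(\mathcal{G},\mathcal{P})$ is then a VPG representation of $G$. A branch decomposition for $G$ is a pair $(T,\delta)$ where $T$ is a subcubic tree (maximum degree at most $3$) and $\delta$ is a bijection between $V(G)$ and the leaves of $T$. Each $e\in E(T)$ yields a partition $(A_e,\overline{A_e})$ of $V(G)$ according to which component of $T-e$ contains the corresponding leaves. $G[A_e,\overline{A_e}]$ is the bipartite subgraph of $G$ consisting of the edges with one endpoint in each of the two classes. An induced matching in a graph is a set $M$ of pairwise non-incident edges such that no two vertices belonging to different edges of $M$ are adjacent in that graph. Let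 $\mathrm{cutmim}_G(A_e,\overline{A_e})$ be the size of a maximum induced matching in $G[A_e,\overline{A_e}]$, $\mathrm{mimw}_G(T,\delta)=\max_{e\in E(T)}\mathrm{cutmim}_G(A_e,\overline{A_e})$, and the mim-width $\mathrm{mimw}(G)$ be the minimum of $\mathrm{mimw}_G(T,\delta)$ over all branch decompositions for $G$. A class of graphs has bounded mim-width if there is a constant $w$ with $\mathrm{mimw}(G)\leq w$ for all $G$ in the class. -}

module Defs where

open import Data.Fin using (Fin; toℕ)
open import Data.Fin.Subset using (Subset; _∈_; _∉_)
open import Data.List using (List; []; _∷_; _++_; [_]; length; filter; allFin)
open import Data.List.Relation.Unary.All using (All)
open import Data.List.Relation.Unary.AllPairs using (AllPairs)
open import Data.List.Relation.Unary.Linked using (Linked)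
open import Data.List.Relation.Unary.Unique.Propositional using (Unique)
import Data.List.Membership.Propositional as List
open import Data.Nat using (ℕ; _+_; _^_; _≤_; ∣_-_∣)
open import Data.Product using (_×_; _,_; ∃; ∃-syntax; Σ-syntax; proj₁; uncurry)
open import Data.Sum using (_⊎_)
open import Function.Bundles using (_⤖_; _⇔_; module Bijection)
open import Level using (Level; 0ℓ)
open import Relation.Binary using (Rel; Decidable; Symmetric; Irreflexive)
open import Relation.Binary.Construct.Closure.ReflexiveTransitive using (Star)
open import Relation.Binary.PropositionalEquality using (_≡_; _≢_)
open import Relation.Nullary using (¬_)
open import Relation.Unary using (Pred)

private
  variable
    a ℓ : Level
    A : Set a

IsMaximum : Pred ℕ ℓ → Pred ℕ ℓ
IsMaximum P m = P m × (∀ k → P k → k ≤ m)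

IsMinimum : Pred ℕ ℓ → Pred ℕ ℓ
IsMinimum P m = P m × (∀ k → P k → m ≤ k)

record Graph : Set₁ where
  field
    order  : ℕ
    Adj    : Rel (Fin order) 0ℓ
    adj?   : Decidable Adj
    sym    : Symmetric Adj
    irrefl : Irreflexive _≡_ Adj

  Vertex : Set
  Vertex = Fin order

  degree : Vertex → ℕ
  degree v = length (filter (adj? v) (allFin order))

open Graph public using (Vertex)

GraphClass : Set₁
GraphClass = Pred Graph 0ℓ

IsSplitGraph : GraphClass
IsSplitGraph G = ∃[ K ] Clique K × IndependentComplement K
  where
  open Graph G using (order; Adj)

  Clique : Subset order → Set
  Clique K = ∀ u v → u ∈ K → v ∈ K → u ≢ v → Adj u v

  IndependentComplement : Subset order → Set
  IndependentComplement K = ∀ u v → u ∉ K → v ∉ K → ¬ Adj u v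

-- A grid with c columns and r rows; (i , j) is the point of column i and
-- row j.  Coordinates start at 0 instead of 1.
GridPoint : ℕ → ℕ → Set
GridPoint c r = Fin c × Fin r

-- Euclidean distance 1 is expressed as squared distance 1.
dist² : ∀ {c r} → GridPoint c r → GridPoint c r → ℕ
dist² (x , y) (x′ , y′) =
  ∣ toℕ x - toℕ x′ ∣ ^ 2 + ∣ toℕ y - toℕ y′ ∣ ^ 2

GridAdj : ∀ {c r} → Rel (GridPoint c r) 0ℓ
GridAdj p q = dist² p q ≡ 1

-- Vertex sets of graphs are of the form Fin n, so being a grid graph is
-- expressed up to isomorphism.
IsGridGraph : GraphClass
IsGridGraph G =
  ∃[ a ] ∃[ b ] 1 ≤ a × 1 ≤ b ×
  Σ[ φ ∈ Vertex G ⤖ GridPoint a b ]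
    (∀ u v → Graph.Adj G u v ⇔ GridAdj (Bijection.to φ u) (Bijection.to φ v))

record GridPath (c r : ℕ) : Set where
  field
    points     : List (GridPoint c r)
    linked     : Linked GridAdj points
    simple     : Unique points
    nontrivial : 2 ≤ length points

open GridPath public using (points)

_∈ᵖ_ : ∀ {c r} → GridPoint c r → GridPath c r → Set
p ∈ᵖ P = p List.∈ points P

Consecutive : A → A → List A → Set _
Consecutive x y zs = ∃[ pre ] ∃[ post ] zs ≡ pre ++ x ∷ y ∷ post

-- The undirected grid-edge {p , q} belongs to the path.
EdgeOf : ∀ {c r} → GridPath c r → GridPoint c r → GridPoint c r → Set
EdgeOf P p q = Consecutive p q (points P) ⊎ Consecutive q p (points P)

-- Equality of paths as subgraphs of the grid: the list of points of a
-- path and its reversal describe the same path.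
SamePath : ∀ {c r} → GridPath c r → GridPath c r → Set
SamePath P Q = ∀ p q → EdgeOf P p q ⇔ EdgeOf Q p q

record VPGRepresentation (G : Graph) : Set where
  field
    columns rows : ℕ
    path         : Vertex G → GridPath columns rows
    -- With this, the vertices are in one-to-one correspondence with the
    -- set of paths { path v }.
    injective    : ∀ u v → SamePath (path u) (path v) → u ≡ v
    represents   : ∀ u v → u ≢ v →
                   Graph.Adj G u v ⇔ (∃[ p ] p ∈ᵖ path u × p ∈ᵖ path v)

AtMostOnePathPerEdge : ∀ {G} → VPGRepresentation G → Set
AtMostOnePathPerEdge R =
  ∀ p q → GridAdj p q → ∀ u v → EdgeOf (path u) p q → EdgeOf (path v) p q → u ≡ v
  where open VPGRepresentation R

Connected : Graph → Set
Connected G = ∀ u v → Star (Graph.Adj G) u v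

-- The cycle with successive vertices u , vs , w; it has length at least 3.
IsCycle : (G : Graph) → Vertex G → List (Vertex G) → Vertex G → Set
IsCycle G u vs w =
  vs ≢ [] × Unique cycle × Linked (Graph.Adj G) cycle × Graph.Adj G w u
  where cycle = u ∷ vs ++ [ w ]

Acyclic : Graph → Set
Acyclic G = ∀ u vs w → ¬ IsCycle G u vs w

-- The graph without vertices is not excluded; below it can only occur as
-- the tree of a decomposition of the graph without vertices.
IsTree : Graph → Set
IsTree T = Connected T × Acyclic T

IsSubcubic : Graph → Set
IsSubcubic T = ∀ v → Graph.degree T v ≤ 3

-- In a tree with at least two vertices this means degree 1.  The vertex
-- of a one-vertex tree counts as a leaf, so that the graph with one
-- vertex has a branch decomposition.
IsLeaf : (T : Graph) → Vertex T → Set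
IsLeaf T v = Graph.degree T v ≤ 1

-- Adjacency in T - {s , t}.
AdjWithout : (T : Graph) → Vertex T → Vertex T → Rel (Vertex T) 0ℓ
AdjWithout T s t u v =
  Graph.Adj T u v × ¬ ((u ≡ s × v ≡ t) ⊎ (u ≡ t × v ≡ s))

-- Adjacency in G[X , Y].
CutAdj : (G : Graph) (X Y : Pred (Vertex G) 0ℓ) → Rel (Vertex G) 0ℓ
CutAdj G X Y u v = Graph.Adj G u v × ((X u × Y v) ⊎ (Y u × X v))

_∈ᵉ_ : A → A × A → Set _
x ∈ᵉ (u , v) = x ≡ u ⊎ x ≡ v

Separated : Rel A 0ℓ → Rel (A × A) _
Separated _~_ e f = ∀ x y → x ∈ᵉ e → y ∈ᵉ f → x ≢ y × ¬ (x ~ y)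

-- Edges are listed once each, in either orientation.
IsInducedMatching : Rel A 0ℓ → Pred (List (A × A)) _
IsInducedMatching _~_ M = All (uncurry _~_) M × AllPairs (Separated _~_) M

IsCutmim : (G : Graph) (X Y : Pred (Vertex G) 0ℓ) → Pred ℕ 0ℓ
IsCutmim G X Y =
  IsMaximum (λ k → ∃[ M ] IsInducedMatching (CutAdj G X Y) M × length M ≡ k)

record BranchDecomposition (G : Graph) : Set₁ where
  field
    tree     : Graph
    isTree   : IsTree tree
    subcubic : IsSubcubic tree
    δ        : Vertex G ⤖ ∃ (IsLeaf tree)

  -- For e = {s , t}, the partition of the vertices of G is given by
  -- Side s t and Side t s, as tree - e has one component containing s
  -- and one containing t.
  Side : (s t : Vertex tree) → Pred (Vertex G) 0ℓ
  Side s t v = Star (AdjWithout tree s t) s (proj₁ (Bijection.to δ v))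

-- The maximum over all edges of the tree, which is 0 if there are none.
IsDecompositionMimWidth : ∀ {G} → BranchDecomposition G → Pred ℕ 0ℓ
IsDecompositionMimWidth {G} D =
  IsMaximum (λ k → k ≡ 0 ⊎
    (∃[ s ] ∃[ t ] Graph.Adj tree s t × IsCutmim G (Side s t) (Side t s) k))
  where open BranchDecomposition D

IsMimWidth : Graph → Pred ℕ _
IsMimWidth G =
  IsMinimum (λ k → Σ[ D ∈ BranchDecomposition G ] IsDecompositionMimWidth D k)

BoundedMimWidth : GraphClass → Set₁
BoundedMimWidth C =
  ∃[ w ] (∀ G → C G → ∃[ k ] IsMimWidth G k × k ≤ w)

{-# OPTIONS --safe #-}

-- Let a cut (X , Y) of a k × k grid have mim-value at most w.  Split the
-- rows meeting both sides into four classes, by the parity of the row and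
-- by the side containing the black end of some edge of the row crossing
-- the cut; within a class these edges form an induced matching, even
-- after the black vertices have been turned into a clique.  So at most
-- 4 w rows, and likewise at most 4 w columns, are mixed, and if k > 4 w
-- one of the sides meets at most 4 w rows ("is small"): otherwise one
-- whole row would lie in X, another one in Y, and all columns would be
-- mixed.  If k > 12 w + 1, then at every vertex of the decomposition tree
-- one of the at most three branches is not small.  Moving into it never
-- backtracks, as the other side of the edge is small, which is impossible
-- in a finite tree.  Grids and split grids thus have mim-width above w.
--
-- In the representation of a grid graph, the corners of the L-shaped paths
-- form a lattice of determinant 3, and the coordinates modulo 3 tell which
-- paths own a given edge.  For a split graph, two rows are reserved for
-- each vertex: an independent vertex is the edge of column 1 between its
-- two rows, and a clique vertex runs along column 0, with a detour through
-- that edge for each independent neighbour and for itself.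
module Submission where

open import Defs
open import Data.Bool using (Bool; true; false)
open import Data.Empty using (⊥; ⊥-elim)
open import Data.Fin using (Fin; toℕ; fromℕ<; combine; remQuot)
import Data.Fin.Properties as Fin
open import Data.Fin.Subset using () renaming (_∈_ to _∈ₛ_; _∉_ to _∉ₛ_)
open import Data.Fin.Subset.Properties using () renaming (_∈?_ to _∈ₛ?_)
open import Data.List using (List; []; _∷_; _++_; [_]; length; lookup; filter; allFin; map)
open import Data.List.Properties using (++-assoc; ∷-injectiveˡ; length-++; length-map)
import Data.List.Membership.DecPropositional as DecMembership
open import Data.List.Membership.Propositional using (_∈_)
open import Data.List.Membership.Propositional.Properties
  using (∈-∃++; ∈-lookup; ∈-allFin; ∈-filter⁺; ∈-++⁺ˡ; ∈-++⁺ʳ; ∈-map⁺; ∈-map⁻)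
open import Data.List.Relation.Unary.All as All using (All; []; _∷_; all?)
import Data.List.Relation.Unary.All.Properties as All
open import Data.List.Relation.Unary.AllPairs as AllPairs using (AllPairs; []; _∷_)
import Data.List.Relation.Unary.AllPairs.Properties as AllPairs
open import Data.List.Relation.Unary.Any using (here; there; index)
import Data.List.Relation.Unary.Any.Properties as Any
open import Data.List.Relation.Unary.Linked as Linked using (Linked; []; [-]; _∷_)
import Data.List.Relation.Unary.Linked.Properties as Linked
open import Data.List.Relation.Unary.Unique.Propositional using (Unique)
import Data.List.Relation.Unary.Unique.Propositional.Properties as Unique
open import Data.Nat using (ℕ; zero; suc; _+_; _*_; _^_; _≤_; _<_; z≤n; s≤s; ∣_-_∣; _/_; _%_; ⌊_/2⌋; parity)
open import Data.Nat.Divisibility using (n∣m*n)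
open import Data.Nat.DivMod using ([m+kn]%n≡m%n; +-distrib-/-∣ˡ; m*n/n≡m)
import Data.Nat.Properties as ℕ
open import Data.Nat.Solver using (module +-*-Solver)
open import Data.Parity using (Parity; 0ℙ; 1ℙ; _⁻¹)
import Data.Parity.Properties as Parity
open import Data.Product as Product using (_×_; _,_; ∃; ∃-syntax; Σ-syntax; proj₁; proj₂; swap)
import Data.Product.Properties as Product
open import Data.Sum as Sum using (_⊎_; inj₁; inj₂; [_,_]′)
open import Data.Vec using (tabulate)
open import Data.Vec.Properties using (lookup∘tabulate; []=⇒lookup; lookup⇒[]=)
open import Function using (_∘_)
open import Function.Bundles using (module Bijection; module Equivalence; mk⇔)
open import Function.Construct.Symmetry using (⇔-sym)
open import Function.Properties.Inverse using (↔⇒⤖)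
open import Level using (0ℓ)
open import Relation.Binary using (Rel; DecidableEquality; Symmetric)
open import Relation.Binary.Construct.Closure.ReflexiveTransitive as Star
  using (Star; ε; _◅_; _◅◅_; return; reverse; gmap)
open import Relation.Binary.PropositionalEquality using (_≡_; _≢_; refl; sym; trans; cong; cong₂; subst; subst₂)
open import Relation.Nullary using (¬_; Dec; does; yes; no; contradiction; ¬?)
open import Relation.Nullary.Decidable
  using (_×-dec_; _⊎-dec_; _→-dec_; ¬¬-excluded-middle; dec-true; dec-false; decidable-stable; from-yes)
open import Relation.Unary using (Pred; Decidable)

-- Lists

module _ {A : Set} where

  AllPairs-++⁻ˡ : {R : Rel A 0ℓ} → ∀ xs {ys} → AllPairs R (xs ++ ys) → AllPairs R xs
  AllPairs-++⁻ˡ []       _          = []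
  AllPairs-++⁻ˡ (x ∷ xs) (px ∷ pxs) = All.++⁻ˡ xs px ∷ AllPairs-++⁻ˡ xs pxs

  AllPairs-++⁻ʳ : {R : Rel A 0ℓ} → ∀ xs {ys} → AllPairs R (xs ++ ys) → AllPairs R ys
  AllPairs-++⁻ʳ []       pxs        = pxs
  AllPairs-++⁻ʳ (x ∷ xs) (_  ∷ pxs) = AllPairs-++⁻ʳ xs pxs

  Linked-++⁻ˡ : {R : Rel A 0ℓ} → ∀ xs {ys} → Linked R (xs ++ ys) → Linked R xs
  Linked-++⁻ˡ []           _        = []
  Linked-++⁻ˡ (x ∷ [])     _        = [-]
  Linked-++⁻ˡ (x ∷ y ∷ xs) (r ∷ rs) = r ∷ Linked-++⁻ˡ (y ∷ xs) rs

  Linked-++⁻ʳ : {R : Rel A 0ℓ} → ∀ xs {ys} → Linked R (xs ++ ys) → Linked R ys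
  Linked-++⁻ʳ []       rs = rs
  Linked-++⁻ʳ (x ∷ xs) rs = Linked-++⁻ʳ xs (Linked.tail rs)

  lookup-injective : ∀ {xs : List A} → Unique xs → ∀ {i j} → lookup xs i ≡ lookup xs j → i ≡ j
  lookup-injective (_  ∷ _)   {Fin.zero}  {Fin.zero}  _  = refl
  lookup-injective (px ∷ _)   {Fin.zero}  {Fin.suc j} eq = contradiction eq (All.lookup px (∈-lookup j))
  lookup-injective (px ∷ _)   {Fin.suc i} {Fin.zero}  eq = contradiction (sym eq) (All.lookup px (∈-lookup i))
  lookup-injective (_  ∷ pxs) {Fin.suc i} {Fin.suc j} eq = cong Fin.suc (lookup-injective pxs eq)

unique⇒length≤ : ∀ {n} {xs : List (Fin n)} → Unique xs → length xs ≤ n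
unique⇒length≤ uxs = Fin.injective⇒≤ (lookup-injective uxs)

exhaustive⇒≤length : ∀ {n} (xs : List (Fin n)) → (∀ i → i ∈ xs) → n ≤ length xs
exhaustive⇒≤length xs all∈ = Fin.injective⇒≤ {f = index ∘ all∈}
  λ {i} {j} eq → trans (Any.lookup-index (all∈ i)) (trans (cong (lookup xs) eq) (sym (Any.lookup-index (all∈ j))))

-- Double negation

-- Over a finite index set, double negation shifts past the quantifier. A proof of `⊥` may thus
-- assume decisions for all vertices at once.
¬¬-∀Fin : ∀ {ℓ} {n} {P : Pred (Fin n) ℓ} → (∀ i → ¬ ¬ P i) → ¬ ¬ (∀ i → P i)
¬¬-∀Fin {n = zero}  _  k = k λ ()
¬¬-∀Fin {n = suc n} nn k = nn Fin.zero λ p₀ → ¬¬-∀Fin (nn ∘ Fin.suc) λ p →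
  k λ { Fin.zero → p₀ ; (Fin.suc i) → p i }

-- Induction on the gap `d` between a known value `k` and the upper bound: a larger value narrows
-- the gap. As `P` is arbitrary, the maximum is only obtained under a double negation.
¬¬-maximum : ∀ {ℓ} {P : Pred ℕ ℓ} d {k} → P k → (∀ j → P j → j ≤ k + d) → ¬ ¬ ∃ (IsMaximum P)
¬¬-maximum zero {k} pk bound no-max =
  no-max (k , pk , λ j pj → subst (j ≤_) (ℕ.+-identityʳ k) (bound j pj))
¬¬-maximum {P = P} (suc d) {k} pk bound no-max = no-max (k , pk , below)
  where
  below : ∀ j → P j → j ≤ k
  below j pj with j ℕ.≤? k
  ... | yes j≤k = j≤k
  ... | no  j≰k = ⊥-elim (¬¬-maximum d pj bound′ no-max)
    where
    bound′ : ∀ i → P i → i ≤ j + d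
    bound′ i pi = ℕ.≤-trans (subst (i ≤_) (ℕ.+-suc k d) (bound i pi)) (ℕ.+-monoˡ-≤ d (ℕ.≰⇒> j≰k))

-- Walks, paths and cycles

module _ {A : Set} (_≟_ : DecidableEquality A) (R : Rel A 0ℓ) where
  open DecMembership _≟_ using (_∈?_)

  -- If the start recurs on the simple path found for the rest of the walk, everything before the
  -- recurrence is dropped. The list has the form required by `IsCycle`.
  simplify : ∀ {x y} → Star R x y → x ≡ y ⊎ ∃[ zs ] Unique (x ∷ zs ++ [ y ]) × Linked R (x ∷ zs ++ [ y ])
  simplify ε = inj₁ refl
  simplify {x} {y} (_◅_ {j = u} xRu walk) with x ≟ y
  ... | yes x≡y = inj₁ x≡y
  ... | no  x≢y with simplify walk
  ... | inj₁ refl = inj₂ ([] , (x≢y ∷ []) ∷ [] ∷ [] , xRu ∷ [-])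
  ... | inj₂ (zs , uniq , link) with x ∈? (u ∷ zs)
  ... | no  x∉ = inj₂ (u ∷ zs , All.++⁺ (All.¬Any⇒All¬ (u ∷ zs) x∉) (x≢y ∷ []) ∷ uniq , xRu ∷ link)
  ... | yes x∈ with pre , post , eq ← ∈-∃++ x∈ =
    inj₂ (post , AllPairs-++⁻ʳ pre (subst Unique split uniq) , Linked-++⁻ʳ pre (subst (Linked R) split link))
    where
    split : u ∷ zs ++ [ y ] ≡ pre ++ x ∷ post ++ [ y ]
    split = trans (cong (_++ [ y ]) eq) (++-assoc pre (x ∷ post) [ y ])

module _ (T : Graph) (acyclic : Acyclic T) where
  open Graph T using (order; Adj)
  open DecMembership (Fin._≟_ {order}) using (_∈?_)

  -- The walk along `next` must repeat a vertex. Irreflexivity and `no-return` exclude a return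
  -- after one or two steps, so the first repetition closes a cycle of length at least 3.
  backtracks : (next : Vertex T → Vertex T) → (∀ v → Adj v (next v)) → (∀ v → next (next v) ≢ v) → ¬ Vertex T
  backtracks next adj no-return v₀ = extend (suc order) v₀ [] ([] ∷ []) [-] (s≤s (ℕ.n≤1+n order))
    where
    -- The visited vertices are listed latest first. Once the fuel is used up, there are more
    -- distinct vertices than the tree has.
    extend : ∀ fuel v vs → Unique (v ∷ vs) → Linked (λ x y → x ≡ next y) (v ∷ vs) →
             order < length (v ∷ vs) + fuel → ⊥
    extend zero v vs uniq link big =
      ℕ.<⇒≱ big (ℕ.≤-trans (ℕ.≤-reflexive (ℕ.+-identityʳ _)) (unique⇒length≤ uniq))
    extend (suc fuel) v vs uniq link big with next v ∈? (v ∷ vs)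
    ... | no fresh = extend fuel (next v) (v ∷ vs) (All.¬Any⇒All¬ (v ∷ vs) fresh ∷ uniq) (refl ∷ link)
                       (subst (order <_) (ℕ.+-suc (length (v ∷ vs)) fuel) big)
    ... | yes old with ∈-∃++ old
    ... | [] , post , eq = contradiction (adj v) (Graph.irrefl T (∷-injectiveˡ eq))
    ... | x ∷ [] , post , refl = no-return v (sym (Linked.head link))
    ... | x ∷ y ∷ pre , post , refl =
      acyclic x (y ∷ pre) (next v)
        ((λ ()) , AllPairs-++⁻ˡ cycle (subst Unique split uniq) ,
         Linked-++⁻ˡ cycle (Linked.map edge (subst (Linked _) split link)) ,
         Graph.sym T (adj v))
      where
      cycle = x ∷ y ∷ pre ++ [ next v ]
      split : x ∷ y ∷ pre ++ next v ∷ post ≡ cycle ++ post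
      split = cong (λ l → x ∷ y ∷ l) (sym (++-assoc pre [ next v ] post))
      edge : ∀ {a b} → a ≡ next b → Adj a b
      edge {b = b} refl = Graph.sym T (adj b)

-- Removing an edge of a tree

module _ (T : Graph) (isTree : IsTree T) where
  open Graph T using (order; Adj)

  without-sym : ∀ s t → Symmetric (AdjWithout T s t)
  without-sym s t (uv , not-st) = Graph.sym T uv , λ
    { (inj₁ (v≡s , u≡t)) → not-st (inj₂ (u≡t , v≡s))
    ; (inj₂ (v≡t , u≡s)) → not-st (inj₁ (u≡s , v≡t)) }

  without-swap : ∀ {s t u v} → AdjWithout T s t u v → AdjWithout T t s u v
  without-swap (uv , not-st) = uv , λ { (inj₁ ts) → not-st (inj₂ ts) ; (inj₂ st) → not-st (inj₁ st) }

  -- Induction along a walk from `x` to `s`: while `x` is neither end of the edge, its next step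
  -- cannot use that edge.
  components-cover : ∀ s t x → Star (AdjWithout T s t) s x ⊎ Star (AdjWithout T t s) t x
  components-cover s t x = extend (proj₁ isTree x s)
    where
    extend : ∀ {x} → Star Adj x s → Star (AdjWithout T s t) s x ⊎ Star (AdjWithout T t s) t x
    extend ε = inj₁ ε
    extend {x} (_◅_ {j = y} xy walk) with x Fin.≟ s | x Fin.≟ t
    ... | yes refl | _        = inj₁ ε
    ... | no _     | yes refl = inj₂ ε
    ... | no x≢s   | no x≢t with extend walk
    ... | inj₁ walkₛ = inj₁ (walkₛ ◅◅ return (Graph.sym T xy , λ { (inj₁ (_ , e)) → x≢t e ; (inj₂ (_ , e)) → x≢s e }))
    ... | inj₂ walkₜ = inj₂ (walkₜ ◅◅ return (Graph.sym T xy , λ { (inj₁ (_ , e)) → x≢s e ; (inj₂ (_ , e)) → x≢t e }))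

  -- A common vertex yields a walk from `s` to `t` avoiding the edge. Made simple, it has an inner
  -- vertex, and the edge closes it to a cycle.
  components-disjoint : ∀ {s t} → Adj s t → ∀ {x} → Star (AdjWithout T s t) s x → ¬ Star (AdjWithout T t s) t x
  components-disjoint {s} {t} st walkₛ walkₜ
    with simplify Fin._≟_ _ (walkₛ ◅◅ reverse (without-sym s t) (Star.map without-swap walkₜ))
  ... | inj₁ s≡t = Graph.irrefl T s≡t st
  ... | inj₂ ([] , _ , ((_ , not-st) ∷ _)) = not-st (inj₁ (refl , refl))
  ... | inj₂ (z ∷ zs , uniq , link) =
    proj₂ isTree s (z ∷ zs) t ((λ ()) , uniq , Linked.map proj₁ link , Graph.sym T st)

  -- The branch of `x` is named by the vertex from which a walk from `x` first enters `u`.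
  branches-cover : ∀ u x → x ≡ u ⊎ ∃[ w ] Adj u w × Star (AdjWithout T w u) w x
  branches-cover u x = extend (proj₁ isTree x u)
    where
    extend : ∀ {x} → Star Adj x u → x ≡ u ⊎ ∃[ w ] Adj u w × Star (AdjWithout T w u) w x
    extend ε = inj₁ refl
    extend {x} (_◅_ {j = y} xy walk) with x Fin.≟ u
    ... | yes x≡u = inj₁ x≡u
    ... | no  x≢u with extend walk
    ... | inj₁ refl = inj₂ (x , Graph.sym T xy , ε)
    ... | inj₂ (w , uw , walkᵤ) with y Fin.≟ u
    ... | yes refl = inj₂ (x , Graph.sym T xy , ε)
    ... | no  y≢u  = inj₂ (w , uw , walkᵤ ◅◅ return (Graph.sym T xy , λ { (inj₁ (_ , e)) → x≢u e ; (inj₂ (e , _)) → y≢u e }))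

-- Adjacency and colours in a grid

x²+y²≡1 : ∀ x y → x ^ 2 + y ^ 2 ≡ 1 → (x ≡ 0 × y ≡ 1) ⊎ (x ≡ 1 × y ≡ 0)
x²+y²≡1 0             0             ()
x²+y²≡1 0             1             _  = inj₁ (refl , refl)
x²+y²≡1 0             (suc (suc y)) ()
x²+y²≡1 1             0             _  = inj₂ (refl , refl)
x²+y²≡1 1             (suc y)       ()
x²+y²≡1 (suc (suc x)) y             ()

∣i-j∣≡0⇒i≡j : ∀ {n} (i j : Fin n) → ∣ toℕ i - toℕ j ∣ ≡ 0 → i ≡ j
∣i-j∣≡0⇒i≡j i j eq = Fin.toℕ-injective (ℕ.∣m-n∣≡0⇒m≡n eq)

gridAdj? : ∀ {c r} (p q : GridPoint c r) → Dec (GridAdj p q)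
gridAdj? p q = dist² p q ℕ.≟ 1

gridAdj-sym : ∀ {c r} (p q : GridPoint c r) → GridAdj p q → GridAdj q p
gridAdj-sym (i , j) (i′ , j′) =
  trans (cong₂ (λ x y → x ^ 2 + y ^ 2) (ℕ.∣-∣-comm (toℕ i′) (toℕ i)) (ℕ.∣-∣-comm (toℕ j′) (toℕ j)))

gridAdj-swap : ∀ {c r} (p q : GridPoint c r) → GridAdj p q → GridAdj (swap p) (swap q)
gridAdj-swap (i , j) (i′ , j′) = trans (ℕ.+-comm (∣ toℕ j - toℕ j′ ∣ ^ 2) _)

parity-step : ∀ m n → ∣ m - n ∣ ≡ 1 → parity m ≢ parity n
parity-step 0       1       _  ()
parity-step 1       0       _  ()
parity-step (suc m) (suc n) eq p≡ = parity-step m n eq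
  (trans (sym (Parity.suc-homo-⁻¹ m)) (trans (cong _⁻¹ p≡) (Parity.suc-homo-⁻¹ n)))

-- The chessboard colouring; points of colour `0ℙ` are called black.
colour : ∀ {c r} → GridPoint c r → Parity
colour (i , j) = parity (toℕ i + toℕ j)

colour-step : ∀ {c r} (p q : GridPoint c r) → GridAdj p q → colour p ≢ colour q
colour-step (i , j) (i′ , j′) adj with x²+y²≡1 ∣ toℕ i - toℕ i′ ∣ ∣ toℕ j - toℕ j′ ∣ adj
... | inj₁ (i≡ , j~) with refl ← ∣i-j∣≡0⇒i≡j i i′ i≡ =
  parity-step (toℕ i + toℕ j) (toℕ i + toℕ j′) (trans (ℕ.∣m+n-m+o∣≡∣n-o∣ (toℕ i) (toℕ j) (toℕ j′)) j~)
... | inj₂ (i~ , j≡) with refl ← ∣i-j∣≡0⇒i≡j j j′ j≡ =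
  parity-step (toℕ i + toℕ j) (toℕ i′ + toℕ j) (trans (cong₂ ∣_-_∣ (ℕ.+-comm (toℕ i) (toℕ j)) (ℕ.+-comm (toℕ i′) (toℕ j)))
    (trans (ℕ.∣m+n-m+o∣≡∣n-o∣ (toℕ j) (toℕ i) (toℕ i′)) i~))

step-along-line : ∀ {c r} (i : Fin c) (j j′ : Fin r) → ∣ toℕ j - toℕ j′ ∣ ≡ 1 → GridAdj (i , j) (i , j′)
step-along-line i _ _ step = cong₂ (λ x y → x ^ 2 + y ^ 2) (ℕ.∣n-n∣≡0 (toℕ i)) step

same-parity-lines : ∀ {c r} {i i′ : Fin c} (j j′ : Fin r) → i ≢ i′ → parity (toℕ i) ≡ parity (toℕ i′) →
                    ¬ GridAdj (i , j) (i′ , j′)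
same-parity-lines {i = i} {i′} j j′ i≢i′ par adj with x²+y²≡1 ∣ toℕ i - toℕ i′ ∣ ∣ toℕ j - toℕ j′ ∣ adj
... | inj₁ (i≡ , _) = i≢i′ (∣i-j∣≡0⇒i≡j i i′ i≡)
... | inj₂ (i~ , _) = parity-step (toℕ i) (toℕ i′) i~ par

Fin-walk : ∀ {n} (i j : Fin n) → Star (λ i j → ∣ toℕ i - toℕ j ∣ ≡ 1) i j
Fin-walk {suc n} i j = reverse (λ {x} {y} → trans (ℕ.∣-∣-comm (toℕ y) (toℕ x))) (from-zero i) ◅◅ from-zero j
  where
  from-zero : ∀ {n} (j : Fin (suc n)) → Star (λ i j → ∣ toℕ i - toℕ j ∣ ≡ 1) Fin.zero j
  from-zero         Fin.zero    = ε
  from-zero {suc n} (Fin.suc j) = refl ◅ gmap Fin.suc (λ eq → eq) (from-zero j)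

-- Cuts of small mim-value

-- Treats grids and split grids at once: the extra edges tolerated by `adj⁻` are those of the clique
-- on the black points. Lines are indexed by the first coordinate, and `transpose` gives the other
-- direction.
record GridLike (G : Graph) (k : ℕ) : Set where
  field
    cell      : GridPoint k k → Vertex G
    injective : ∀ {p q} → cell p ≡ cell q → p ≡ q
    adj⁺      : ∀ p q → GridAdj p q → Graph.Adj G (cell p) (cell q)
    adj⁻      : ∀ p q → Graph.Adj G (cell p) (cell q) → GridAdj p q ⊎ (colour p ≡ 0ℙ × colour q ≡ 0ℙ)

  Meets : Pred (Vertex G) 0ℓ → Pred (Fin k) 0ℓ
  Meets X i = ∃[ j ] X (cell (i , j))

transpose : ∀ {G k} → GridLike G k → GridLike G k
transpose H = record
  { cell      = cell ∘ swap
  ; injective = cong swap ∘ injective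
  ; adj⁺      = λ p q → adj⁺ (swap p) (swap q) ∘ gridAdj-swap p q
  ; adj⁻      = λ p q adj → Sum.map (gridAdj-swap (swap p) (swap q))
      (λ (p₀ , q₀) → trans (cong parity (ℕ.+-comm (toℕ (proj₁ p)) _)) p₀ ,
                     trans (cong parity (ℕ.+-comm (toℕ (proj₁ q)) _)) q₀) (adj⁻ (swap p) (swap q) adj)
  }
  where open GridLike H

MimAtMost : (G : Graph) (X Y : Pred (Vertex G) 0ℓ) → Pred ℕ 0ℓ
MimAtMost G X Y w = ∀ M → IsInducedMatching (CutAdj G X Y) M → length M ≤ w

mimAtMost-swap : ∀ {G X Y w} → MimAtMost G X Y w → MimAtMost G Y X w
mimAtMost-swap bound M (edges , separated) =
  bound M (All.map flip edges , AllPairs.map (λ sep x y x∈ y∈ → Product.map₂ (_∘ flip) (sep x y x∈ y∈)) separated)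
  where
  flip : ∀ {A B C : Set} → A × (B ⊎ C) → A × (C ⊎ B)
  flip (a , s) = a , Sum.swap s

module _ {G : Graph} {k w : ℕ} (H : GridLike G k) where
  open GridLike H
  open Graph G using (Adj)

  -- As the black end has to be in `P`, an edge between `X` and `Y` is a crossing for exactly one of
  -- the orders `X Y` and `Y X`.
  record Crossing (P Q : Pred (Vertex G) 0ℓ) (parityᵢ : Parity) (i : Fin k) : Set where
    constructor crossing
    field
      {pos pos′} : Fin k
      lineParity : parity (toℕ i) ≡ parityᵢ
      adjacent   : GridAdj (i , pos) (i , pos′)
      black      : colour (i , pos) ≡ 0ℙ
      inP        : P (cell (i , pos))
      inQ        : Q (cell (i , pos′))

    edge : Vertex G × Vertex G
    edge = cell (i , pos) , cell (i , pos′)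

  crossing? : ∀ {P Q} → Decidable P → Decidable Q → ∀ π → Decidable (Crossing P Q π)
  crossing? {P} {Q} P? Q? π i
    with parity (toℕ i) Parity.≟ π
       | Fin.any? (λ j → Fin.any? λ j′ → gridAdj? (i , j) (i , j′) ×-dec
           (colour (i , j) Parity.≟ 0ℙ ×-dec (P? (cell (i , j)) ×-dec Q? (cell (i , j′)))))
  ... | no  i≢π | _ = no (i≢π ∘ Crossing.lineParity)
  ... | yes _   | no none = no λ (crossing _ a b p q) → none (_ , _ , a , b , p , q)
  ... | yes i≡π | yes (_ , _ , a , b , p , q) = yes (crossing i≡π a b p q)

  module _ {P Q : Pred (Vertex G) 0ℓ} (disjoint : ∀ {v} → P v → ¬ Q v) {π : Parity} where

    -- Two black ends are both in `P`, so no edge between them crosses the cut. Any other pair has a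
    -- white end, which excludes clique edges, and distinct lines of equal parity are not joined by
    -- grid-edges.
    crossings-separated : ∀ {i i′} → i ≢ i′ → (e : Crossing P Q π i) (f : Crossing P Q π i′) →
                          Separated (CutAdj G P Q) (Crossing.edge e) (Crossing.edge f)
    crossings-separated {i} {i′} i≢i′ (crossing {j} {j′} πᵢ a b p q) (crossing {l} {l′} πᵢ′ a′ b′ p′ q′) = sep
      where
      par = trans πᵢ (sym πᵢ′)
      differ : ∀ {j l} → cell (i , j) ≢ cell (i′ , l)
      differ eq = i≢i′ (cong proj₁ (injective eq))
      sep : Separated (CutAdj G P Q) (cell (i , j) , cell (i , j′)) (cell (i′ , l) , cell (i′ , l′))
      sep _ _ (inj₁ refl) (inj₁ refl) = differ , λ
        { (_ , inj₁ (_ , q)) → disjoint p′ q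
        ; (_ , inj₂ (q , _)) → disjoint p q }
      sep _ _ (inj₁ refl) (inj₂ refl) = differ , λ (adj , _) →
        [ same-parity-lines j l′ i≢i′ par , (λ (_ , b″) → colour-step (i′ , l) (i′ , l′) a′ (trans b′ (sym b″))) ]′ (adj⁻ (i , j) (i′ , l′) adj)
      sep _ _ (inj₂ refl) (inj₁ refl) = differ , λ (adj , _) →
        [ same-parity-lines j′ l i≢i′ par , (λ (b″ , _) → colour-step (i , j) (i , j′) a (trans b (sym b″))) ]′ (adj⁻ (i , j′) (i′ , l) adj)
      sep _ _ (inj₂ refl) (inj₂ refl) = differ , λ (adj , _) →
        [ same-parity-lines j′ l′ i≢i′ par , (λ (b″ , _) → colour-step (i , j) (i , j′) a (trans b (sym b″))) ]′ (adj⁻ (i , j′) (i′ , l′) adj)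

    crossings-matching : ∀ {L} → Unique L → All (Crossing P Q π) L →
                         ∃[ M ] IsInducedMatching (CutAdj G P Q) M × length M ≡ length L
    crossings-matching uniq es = matching es , (edges es , separated uniq es) , length-matching es
      where
      matching : ∀ {L} → All (Crossing P Q π) L → List (Vertex G × Vertex G)
      matching = All.reduce Crossing.edge
      edges : ∀ {L} (es : All (Crossing P Q π) L) → All _ (matching es)
      edges []                        = []
      edges (crossing _ a _ p q ∷ es) = (adj⁺ _ _ a , inj₁ (p , q)) ∷ edges es
      separated-from : ∀ {i L} (e : Crossing P Q π i) → All (i ≢_) L → (es : All (Crossing P Q π) L) →
                       All (Separated (CutAdj G P Q) (Crossing.edge e)) (matching es)
      separated-from e []         []       = []
      separated-from e (i≢ ∷ i≢s) (f ∷ es) = crossings-separated i≢ e f ∷ separated-from e i≢s es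
      separated : ∀ {L} → Unique L → (es : All (Crossing P Q π) L) →
                  AllPairs (Separated (CutAdj G P Q)) (matching es)
      separated []          []       = []
      separated (i≢ ∷ uniq) (e ∷ es) = separated-from e i≢ es ∷ separated uniq es
      length-matching : ∀ {L} (es : All (Crossing P Q π) L) → length (matching es) ≡ length L
      length-matching []       = refl
      length-matching (_ ∷ es) = cong suc (length-matching es)

    few-crossings : (P? : Decidable P) (Q? : Decidable Q) → MimAtMost G P Q w →
                    length (filter (crossing? P? Q? π) (allFin k)) ≤ w
    few-crossings P? Q? bound
      with M , induced , eq ← crossings-matching (Unique.filter⁺ (crossing? P? Q? π) (Unique.allFin⁺ k))
                                (All.all-filter (crossing? P? Q? π) (allFin k))
      = subst (_≤ w) eq (bound M induced)

  module _ {X Y : Pred (Vertex G) 0ℓ} (X? : Decidable X) (Y? : Decidable Y)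
           (cover : ∀ v → X v ⊎ Y v) (disjoint : ∀ {v} → X v → ¬ Y v)
           (bound : MimAtMost G X Y w) where

    change-along-line : ∀ {i} → Meets X i → Meets Y i →
      ∃[ j ] ∃[ j′ ] GridAdj (i , j) (i , j′) × X (cell (i , j)) × Y (cell (i , j′))
    change-along-line {i} (j , x) (j′ , y) = change (Fin-walk j j′) x
      where
      change : ∀ {j} → Star (λ i j → ∣ toℕ i - toℕ j ∣ ≡ 1) j j′ → X (cell (i , j)) →
               ∃[ j ] ∃[ j′ ] GridAdj (i , j) (i , j′) × X (cell (i , j)) × Y (cell (i , j′))
      change ε x = contradiction y (disjoint x)
      change {j} (_◅_ {j = l} step walk) x with cover (cell (i , l))
      ... | inj₁ x′ = change walk x′
      ... | inj₂ y′ = j , l , step-along-line i j l step , x , y′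

    mixed-lines : ∃[ L ] length L ≤ 4 * w × (∀ i → Meets X i → Meets Y i → i ∈ L)
    mixed-lines = xy 0ℙ ++ xy 1ℙ ++ yx 0ℙ ++ yx 1ℙ , short , mixed∈
      where
      xy = λ π → filter (crossing? X? Y? π) (allFin k)
      yx = λ π → filter (crossing? Y? X? π) (allFin k)

      xy≤w : ∀ π → length (xy π) ≤ w
      xy≤w π = few-crossings disjoint X? Y? bound
      yx≤w : ∀ π → length (yx π) ≤ w
      yx≤w π = few-crossings (λ y x → disjoint x y) Y? X? (mimAtMost-swap {G} {X} {Y} bound)

      _⊕_ : ∀ {m n} {xs ys : List (Fin k)} → length xs ≤ m → length ys ≤ n → length (xs ++ ys) ≤ m + n
      _⊕_ {xs = xs} p q = ℕ.≤-trans (ℕ.≤-reflexive (length-++ xs)) (ℕ.+-mono-≤ p q)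

      short : length (xy 0ℙ ++ xy 1ℙ ++ yx 0ℙ ++ yx 1ℙ) ≤ 4 * w
      short = _⊕_ {xs = xy 0ℙ} (xy≤w 0ℙ) (_⊕_ {xs = xy 1ℙ} (xy≤w 1ℙ) (_⊕_ {xs = yx 0ℙ} (yx≤w 0ℙ)
                (ℕ.≤-trans (yx≤w 1ℙ) (ℕ.≤-reflexive (sym (ℕ.+-identityʳ w))))))

      xy∈ : ∀ {i} π → Crossing X Y π i → i ∈ xy 0ℙ ++ xy 1ℙ ++ yx 0ℙ ++ yx 1ℙ
      xy∈ 0ℙ c = ∈-++⁺ˡ (∈-filter⁺ (crossing? X? Y? 0ℙ) (∈-allFin _) c)
      xy∈ 1ℙ c = ∈-++⁺ʳ (xy 0ℙ) (∈-++⁺ˡ (∈-filter⁺ (crossing? X? Y? 1ℙ) (∈-allFin _) c))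

      yx∈ : ∀ {i} π → Crossing Y X π i → i ∈ xy 0ℙ ++ xy 1ℙ ++ yx 0ℙ ++ yx 1ℙ
      yx∈ 0ℙ c = ∈-++⁺ʳ (xy 0ℙ) (∈-++⁺ʳ (xy 1ℙ) (∈-++⁺ˡ (∈-filter⁺ (crossing? Y? X? 0ℙ) (∈-allFin _) c)))
      yx∈ 1ℙ c = ∈-++⁺ʳ (xy 0ℙ) (∈-++⁺ʳ (xy 1ℙ) (∈-++⁺ʳ (yx 0ℙ) (∈-filter⁺ (crossing? Y? X? 1ℙ) (∈-allFin _) c)))

      mixed∈ : ∀ i → Meets X i → Meets Y i → i ∈ xy 0ℙ ++ xy 1ℙ ++ yx 0ℙ ++ yx 1ℙ
      mixed∈ i mx my with j , j′ , adj , x , y ← change-along-line mx my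
        with colour (i , j) in cⱼ | colour (i , j′) in cⱼ′
      ... | 0ℙ | _  = xy∈ _ (crossing refl adj cⱼ x y)
      ... | 1ℙ | 0ℙ = yx∈ _ (crossing refl (gridAdj-sym (i , j) (i , j′) adj) cⱼ′ y x)
      ... | 1ℙ | 1ℙ = contradiction (trans cⱼ (sym cⱼ′)) (colour-step (i , j) (i , j′) adj)

  Small : Pred (Vertex G) 0ℓ → Set
  Small X = ∃[ L ] length L ≤ 4 * w × (∀ i → Meets X i → i ∈ L)

small-side : ∀ {G k w} (H : GridLike G k) {X Y : Pred (Vertex G) 0ℓ} → Decidable X → Decidable Y →
             (∀ v → X v ⊎ Y v) → (∀ {v} → X v → ¬ Y v) → MimAtMost G X Y w → 4 * w < k →
             Small {w = w} H X ⊎ Small {w = w} H Y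
small-side {k = k} {w} H {X} {Y} X? Y? cover disjoint bound big
  with L , short , mixed∈L ← mixed-lines {w = w} H X? Y? cover disjoint bound
  = decide
  where
  open GridLike H
  open DecMembership (Fin._≟_ {k}) using (_∈?_)
  meets? : ∀ {P} → Decidable P → ∀ i → Dec (Meets P i)
  meets? P? i = Fin.any? λ j → P? (cell (i , j))
  outside? : ∀ {P} → Decidable P → Dec (∃[ i ] Meets P i × ¬ i ∈ L)
  outside? P? = Fin.any? λ i → meets? P? i ×-dec ¬? (i ∈? L)
  inside : ∀ {P} → ¬ (∃[ i ] Meets P i × ¬ i ∈ L) → ∀ i → Meets P i → i ∈ L
  inside none i m with i ∈? L
  ... | yes i∈L = i∈L
  ... | no  i∉L = contradiction (i , m , i∉L) none
  decide : Small {w = w} H X ⊎ Small {w = w} H Y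
  decide with outside? {X} X? | outside? {Y} Y?
  ... | no none | _       = inj₁ (L , short , inside {X} none)
  ... | yes _   | no none = inj₂ (L , short , inside {Y} none)
  -- Both lines avoid `L`, so line `i` lies wholly in `X` and line `i′` wholly in `Y`. Every line of
  -- the other direction is then mixed, which is too many.
  ... | yes (i , mx , i∉L) | yes (i′ , my , i′∉L)
    with L′ , short′ , mixed∈L′ ← mixed-lines {w = w} (transpose H) X? Y? cover disjoint bound
    = contradiction (ℕ.≤-trans (exhaustive⇒≤length L′ λ j → mixed∈L′ j (i , x j) (i′ , y j)) short′) (ℕ.<⇒≱ big)
    where
    x : ∀ j → X (cell (i , j))
    x j with cover (cell (i , j))
    ... | inj₁ x = x
    ... | inj₂ y = contradiction (mixed∈L i mx (j , y)) i∉L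
    y : ∀ j → Y (cell (i′ , j))
    y j with cover (cell (i′ , j))
    ... | inj₁ x = contradiction (mixed∈L i′ (j , x) my) i′∉L
    ... | inj₂ y = y

-- Branch decompositions of grid-like graphs

module _ {G : Graph} where
  open Graph G using (order)

  matching-length : ∀ {R : Rel (Vertex G) 0ℓ} {M} → IsInducedMatching R M → length M ≤ order
  matching-length {R} {M} (_ , separated) =
    subst (_≤ order) (length-map proj₁ M) (unique⇒length≤ (sources separated))
    where
    sources : ∀ {M} → AllPairs (Separated R) M → Unique (map proj₁ M)
    sources separated = AllPairs.map⁺ (AllPairs.map (λ sep → proj₁ (sep _ _ (inj₁ refl) (inj₁ refl))) separated)

  module _ (D : BranchDecomposition G) where
    open BranchDecomposition D

    -- The width bounds a cut only through an exact value of `IsCutmim`, and such a value is at hand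
    -- only up to double negation.
    ¬¬-mimAtMost : ∀ {m w} → IsDecompositionMimWidth D m → m ≤ w → ∀ s t → Graph.Adj tree s t →
                   ¬ ¬ MimAtMost G (Side s t) (Side t s) w
    ¬¬-mimAtMost (_ , maximal) m≤w s t st not-bounded =
      -- The search starts from the empty matching; `order` bounds the gap because the edges of an
      -- induced matching have distinct first ends.
      ¬¬-maximum order ([] , ([] , []) , refl) (λ { _ (_ , induced , refl) → matching-length induced })
        λ (κ , cutmim) → not-bounded λ M induced →
          ℕ.≤-trans (proj₂ cutmim _ (M , induced , refl)) (ℕ.≤-trans (maximal κ (inj₂ (s , t , st , cutmim))) m≤w)

module _ {G : Graph} {k w : ℕ} (H : GridLike G k) (D : BranchDecomposition G) where
  open BranchDecomposition D
  open GridLike H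
  open Graph tree using () renaming (Adj to TreeAdj)

  leaf : Vertex G → Vertex tree
  leaf = proj₁ ∘ Bijection.to δ

  leaf-injective : ∀ {u v} → leaf u ≡ leaf v → u ≡ v
  leaf-injective {u} {v} eq = Bijection.injective δ (leaf≡ (Bijection.to δ u) (Bijection.to δ v) eq)
    where
    leaf≡ : (x y : ∃ (IsLeaf tree)) → proj₁ x ≡ proj₁ y → x ≡ y
    leaf≡ (x , p) (.x , q) refl = cong (x ,_) (ℕ.≤-irrelevant p q)

  -- The vertex `u` is in none of its own branches. If it is the leaf of a cell, it adds one line:
  -- the 1 in `12 * w + 1`.
  line-of-leaf : ∀ u → ∃[ L ] length L ≤ 1 × (∀ i j → leaf (cell (i , j)) ≡ u → i ∈ L)
  line-of-leaf u with Fin.any? (λ i → Fin.any? (λ j → leaf (cell (i , j)) Fin.≟ u))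
  ... | yes (i , j , refl) = [ i ] , ℕ.≤-refl , λ i′ j′ eq → here (cong proj₁ (injective (leaf-injective eq)))
  ... | no  none           = [] , z≤n , λ i j eq → contradiction (i , j , eq) none

  lines-of-branches : ∀ u (ws : List (Vertex tree)) → All (λ x → Small {w = w} H (Side x u)) ws →
                      ∃[ L ] length L ≤ length ws * (4 * w) ×
                        (∀ i j x → x ∈ ws → Side x u (cell (i , j)) → i ∈ L)
  lines-of-branches u [] [] = [] , z≤n , λ _ _ _ ()
  lines-of-branches u (x ∷ ws) ((Lₓ , shortₓ , ∈Lₓ) ∷ smalls)
    with L , short , ∈L ← lines-of-branches u ws smalls =
    Lₓ ++ L , ℕ.≤-trans (ℕ.≤-reflexive (length-++ Lₓ)) (ℕ.+-mono-≤ shortₓ short) , λ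
      { i j _ (here refl) side → ∈-++⁺ˡ (∈Lₓ i (j , side))
      ; i j y (there y∈)  side → ∈-++⁺ʳ Lₓ (∈L i j y y∈ side) }

  module _ (side? : ∀ s t → Decidable (Side s t))
           (small? : ∀ s t → Dec (Small {w = w} H (Side s t)))
           (bound : ∀ s t → TreeAdj s t → MimAtMost G (Side s t) (Side t s) w)
           (large : 12 * w + 1 < k) where

    -- If all branches at `u` were small, at most 3 times `4 * w` lines, together with the line of
    -- `u` itself, would be all `k` lines.
    heavy-branch : ∀ u → ∃[ x ] TreeAdj u x × ¬ Small {w = w} H (Side x u)
    heavy-branch u with Fin.any? (λ x → Graph.adj? tree u x ×-dec ¬? (small? x u))
    ... | yes found = found
    ... | no none = contradiction few (ℕ.<⇒≱ large)
      where
      neighbours = filter (Graph.adj? tree u) (allFin (Graph.order tree))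

      small : ∀ {x} → TreeAdj u x → Small {w = w} H (Side x u)
      small {x} ux with small? x u
      ... | yes s = s
      ... | no ¬s = contradiction (x , ux , ¬s) none

      few : k ≤ 12 * w + 1
      few with L₀ , short₀ , ∈L₀ ← line-of-leaf u
             | L , short , ∈L ← lines-of-branches u neighbours (All.map small (All.all-filter (Graph.adj? tree u) (allFin _)))
        = ℕ.≤-trans (exhaustive⇒≤length (L ++ L₀) covered)
            (ℕ.≤-trans (ℕ.≤-reflexive (length-++ L)) (ℕ.+-mono-≤
              (ℕ.≤-trans short (ℕ.≤-trans (ℕ.*-monoˡ-≤ (4 * w) (subcubic u)) (ℕ.≤-reflexive (sym (ℕ.*-assoc 3 4 w)))))
              short₀))
        where
        covered : ∀ i → i ∈ L ++ L₀
        covered i with branches-cover tree isTree u (leaf (cell (i , i)))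
        ... | inj₁ here-u = ∈-++⁺ʳ L (∈L₀ i i here-u)
        ... | inj₂ (x , ux , side) =
          ∈-++⁺ˡ (∈L i i x (∈-filter⁺ (Graph.adj? tree u) (∈-allFin x) ux) side)

    light-branch : ∀ {s t} → TreeAdj s t → ¬ Small {w = w} H (Side t s) → Small {w = w} H (Side s t)
    light-branch {s} {t} st heavy
      with small-side H (side? s t) (side? t s) (λ v → components-cover tree isTree s t (leaf v))
             (components-disjoint tree isTree st) (bound s t st)
             (ℕ.≤-<-trans (ℕ.≤-trans (ℕ.*-monoˡ-≤ w (ℕ.m≤m+n 4 8)) (ℕ.m≤m+n (12 * w) 1)) large)
    ... | inj₁ small = small
    ... | inj₂ small = contradiction small heavy

    no-decomposition : ⊥
    no-decomposition = backtracks tree (proj₂ isTree) next (proj₁ ∘ proj₂ ∘ heavy-branch) no-return start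
      where
      next : Vertex tree → Vertex tree
      next = proj₁ ∘ heavy-branch

      -- A return would leave neither side of the edge between `v` and `next v` small.
      no-return : ∀ v → next (next v) ≢ v
      no-return v eq =
        subst (λ x → ¬ Small {w = w} H (Side x (next v))) eq (proj₂ (proj₂ (heavy-branch (next v))))
          (light-branch (proj₁ (proj₂ (heavy-branch v))) (proj₂ (proj₂ (heavy-branch v))))

      start : Vertex tree
      start with corner ← fromℕ< (ℕ.≤-<-trans z≤n large) = leaf (cell (corner , corner))

-- The goal is a negation, so excluded middle may be assumed for the finitely many instances of
-- `Side` and `Small`, along with the bound for each tree edge.
gridLike-mimWidth : ∀ {G k w m} → GridLike G k → 12 * w + 1 < k → IsMimWidth G m → ¬ m ≤ w
gridLike-mimWidth {G} {w = w} H large ((D , width) , _) m≤w =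
  ¬¬-∀Fin (λ s → ¬¬-∀Fin λ t → ¬¬-∀Fin λ v → ¬¬-excluded-middle) λ side? →
  ¬¬-∀Fin (λ s → ¬¬-∀Fin λ t → ¬¬-excluded-middle) λ small? →
  ¬¬-∀Fin (λ s → ¬¬-∀Fin λ t → bounded s t) λ bound →
  no-decomposition H D side? small? bound large
  where
  open BranchDecomposition D
  bounded : ∀ s t → ¬ ¬ (Graph.Adj tree s t → MimAtMost G (Side s t) (Side t s) w)
  bounded s t not-bounded with Graph.adj? tree s t
  ... | yes st = ¬¬-mimAtMost D width m≤w s t st λ bound → not-bounded λ _ → bound
  ... | no ¬st = not-bounded λ st → contradiction st ¬st

-- Grids, and grids with a clique on the points of colour 0ℙ

module _ (k : ℕ) where

  point : Fin (k * k) → GridPoint k k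
  point = remQuot k

  vertex : GridPoint k k → Fin (k * k)
  vertex (i , j) = combine i j

  point-vertex : ∀ p → point (vertex p) ≡ p
  point-vertex (i , j) = Fin.remQuot-combine i j

  vertex-injective : ∀ {p q} → vertex p ≡ vertex q → p ≡ q
  vertex-injective {p} {q} eq = trans (sym (point-vertex p)) (trans (cong point eq) (point-vertex q))

  gridAdj-irrefl : ∀ {p q : GridPoint k k} → p ≡ q → ¬ GridAdj p q
  gridAdj-irrefl {p} refl adj = colour-step p p adj refl

  grid : Graph
  grid = record
    { order  = k * k
    ; Adj    = λ u v → GridAdj (point u) (point v)
    ; adj?   = λ u v → gridAdj? (point u) (point v)
    ; sym    = λ {u} {v} → gridAdj-sym (point u) (point v)
    ; irrefl = λ { {u} refl adj → gridAdj-irrefl {point u} refl adj }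
    }

  grid-isGridGraph : 1 ≤ k → IsGridGraph grid
  grid-isGridGraph 1≤k = k , k , 1≤k , 1≤k , ↔⇒⤖ Fin.*↔× , λ u v → mk⇔ (λ adj → adj) (λ adj → adj)

  grid-gridLike : GridLike grid k
  grid-gridLike = record
    { cell      = vertex
    ; injective = vertex-injective
    ; adj⁺      = λ p q → subst₂ GridAdj (sym (point-vertex p)) (sym (point-vertex q))
    ; adj⁻      = λ p q → inj₁ ∘ subst₂ GridAdj (point-vertex p) (point-vertex q)
    }

  Black : Pred (Fin (k * k)) 0ℓ
  Black u = colour (point u) ≡ 0ℙ

  black? : Decidable Black
  black? u = colour (point u) Parity.≟ 0ℙ

  -- The condition `u ≢ v` keeps the black clique free of loops.
  splitGrid : Graph
  splitGrid = record
    { order  = k * k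
    ; Adj    = λ u v → u ≢ v × (GridAdj (point u) (point v) ⊎ (Black u × Black v))
    ; adj?   = λ u v → ¬? (u Fin.≟ v) ×-dec (gridAdj? (point u) (point v) ⊎-dec (black? u ×-dec black? v))
    ; sym    = λ {u} {v} (u≢v , adj) → u≢v ∘ sym , Sum.map (gridAdj-sym (point u) (point v)) swap adj
    ; irrefl = λ u≡v (u≢v , _) → u≢v u≡v
    }

  splitGrid-isSplit : IsSplitGraph splitGrid
  splitGrid-isSplit = K , (λ u v u∈ v∈ u≢v → u≢v , inj₂ (black u∈ , black v∈)) , independent
    where
    K = tabulate (λ u → does (black? u))

    black : ∀ {u} → u ∈ₛ K → Black u
    black {u} u∈ = decidable-stable (black? u) λ ¬b → contradiction
      (trans (sym (dec-false (black? u) ¬b)) (trans (sym (lookup∘tabulate (λ u → does (black? u)) u)) ([]=⇒lookup u∈))) λ ()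

    white : ∀ {u} → u ∉ₛ K → ¬ Black u
    white {u} u∉ bu = u∉ (lookup⇒[]= u K (trans (lookup∘tabulate (λ u → does (black? u)) u) (dec-true (black? u) bu)))

    independent : ∀ u v → u ∉ₛ K → v ∉ₛ K → ¬ Graph.Adj splitGrid u v
    independent u v u∉ v∉ (_ , inj₂ (bu , _)) = white u∉ bu
    independent u v u∉ v∉ (_ , inj₁ adj) with colour (point u) in cᵤ | colour (point v) in cᵥ
    ... | 0ℙ | _  = white u∉ cᵤ
    ... | 1ℙ | 0ℙ = white v∉ cᵥ
    ... | 1ℙ | 1ℙ = colour-step (point u) (point v) adj (trans cᵤ (sym cᵥ))

  splitGrid-gridLike : GridLike splitGrid k
  splitGrid-gridLike = record
    { cell      = vertex
    ; injective = vertex-injective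
    ; adj⁺      = λ p q adj → (λ eq → gridAdj-irrefl (vertex-injective eq) adj) ,
                    inj₁ (subst₂ GridAdj (sym (point-vertex p)) (sym (point-vertex q)) adj)
    ; adj⁻      = λ p q (_ , adj) → Sum.map (subst₂ GridAdj (point-vertex p) (point-vertex q))
                    (λ (bp , bq) → trans (cong colour (sym (point-vertex p))) bp ,
                                   trans (cong colour (sym (point-vertex q))) bq) adj
    }

-- Unboundedness of the mim-width

gridGraphs-unbounded : ¬ BoundedMimWidth IsGridGraph
gridGraphs-unbounded (w , bounded)
  -- The least side length above `12 * w + 1`.
  with m , width , m≤w ← bounded (grid (12 * w + 2))
         (grid-isGridGraph (12 * w + 2) (ℕ.≤-trans (s≤s z≤n) (ℕ.m≤n+m 2 (12 * w)))) =
  gridLike-mimWidth (grid-gridLike (12 * w + 2)) (ℕ.+-monoʳ-< (12 * w) ℕ.≤-refl) width m≤w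

splitGraphs-unbounded : ¬ BoundedMimWidth IsSplitGraph
splitGraphs-unbounded (w , bounded)
  with m , width , m≤w ← bounded (splitGrid (12 * w + 2)) (splitGrid-isSplit (12 * w + 2)) =
  gridLike-mimWidth (splitGrid-gridLike (12 * w + 2)) (ℕ.+-monoʳ-< (12 * w) ℕ.≤-refl) width m≤w

-- Grid paths given by natural coordinates

Coords : Set
Coords = ℕ × ℕ

CoordsAdj : Coords → Coords → Set
CoordsAdj (x , y) (x′ , y′) = ∣ x - x′ ∣ ^ 2 + ∣ y - y′ ∣ ^ 2 ≡ 1

steps : ∀ {A : Set} → List A → List (A × A)
steps (x ∷ y ∷ zs) = (x , y) ∷ steps (y ∷ zs)
steps _            = []

consecutive⇒∈steps : ∀ {A : Set} {x y : A} {zs} → Consecutive x y zs → (x , y) ∈ steps zs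
consecutive⇒∈steps ([]         , _    , refl) = here refl
consecutive⇒∈steps (_ ∷ []     , post , refl) = there (here refl)
consecutive⇒∈steps (_ ∷ z ∷ zs , post , refl) = there (consecutive⇒∈steps (z ∷ zs , post , refl))

steps-map : ∀ {A B : Set} (f : A → B) zs → steps (map f zs) ≡ map (Product.map f f) (steps zs)
steps-map f []           = refl
steps-map f (_ ∷ [])     = refl
steps-map f (x ∷ y ∷ zs) = cong (_ ∷_) (steps-map f (y ∷ zs))

consecutive⇒∈ : ∀ {A : Set} {x y : A} {zs} → Consecutive x y zs → x ∈ zs × y ∈ zs
consecutive⇒∈ (pre , _ , refl) = ∈-++⁺ʳ pre (here refl) , ∈-++⁺ʳ pre (there (here refl))

-- Serves to recover the points of a path from its edges, which are all that `SamePath` compares.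
∈⇒consecutive : ∀ {A : Set} {x : A} {zs} → 2 ≤ length zs → x ∈ zs → ∃[ y ] (Consecutive x y zs ⊎ Consecutive y x zs)
∈⇒consecutive {zs = _ ∷ y ∷ zs} _ (here refl) = y , inj₁ ([] , zs , refl)
∈⇒consecutive {zs = y ∷ _ ∷ zs} _ (there (here refl)) = y , inj₂ ([] , zs , refl)
∈⇒consecutive {zs = z ∷ _ ∷ _ ∷ _} _ (there (there x∈))
  with ∈⇒consecutive (s≤s (s≤s z≤n)) (there x∈)
... | y , inj₁ (pre , post , eq) = y , inj₁ (z ∷ pre , post , cong (z ∷_) eq)
... | y , inj₂ (pre , post , eq) = y , inj₂ (z ∷ pre , post , cong (z ∷_) eq)
∈⇒consecutive {zs = _ ∷ []} (s≤s ()) _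

samePath⇒∈ : ∀ {c r} {P Q : GridPath c r} → SamePath P Q → ∀ {p} → p ∈ᵖ P → p ∈ᵖ Q
samePath⇒∈ {P = P} {Q} same {p} p∈ with ∈⇒consecutive (GridPath.nontrivial P) p∈
... | q , edge with Equivalence.to (same p q) edge
... | inj₁ pq = proj₁ (consecutive⇒∈ pq)
... | inj₂ qp = proj₂ (consecutive⇒∈ qp)

samePath⇒commonEdge : ∀ {c r} (P Q : GridPath c r) → SamePath P Q → ∃[ p ] ∃[ q ] EdgeOf P p q × EdgeOf Q p q
samePath⇒commonEdge record { points = p ∷ q ∷ ps } Q same = p , q , edge , Equivalence.to (same p q) edge
  where
  edge = inj₁ ([] , ps , refl)
samePath⇒commonEdge record { points = _ ∷ [] ; nontrivial = s≤s () }

module _ {c r : ℕ} where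

  coords : GridPoint c r → Coords
  coords (x , y) = toℕ x , toℕ y

  coords-injective : ∀ {p q} → coords p ≡ coords q → p ≡ q
  coords-injective eq = cong₂ _,_ (Fin.toℕ-injective (cong proj₁ eq)) (Fin.toℕ-injective (cong proj₂ eq))

  InGrid : Coords → Set
  InGrid (x , y) = x < c × y < r

  fromCoords : ∀ {ps} → All InGrid ps → ∃[ qs ] map coords qs ≡ ps
  fromCoords []                = [] , refl
  fromCoords ((x< , y<) ∷ ins) with qs , refl ← fromCoords ins =
    (fromℕ< x< , fromℕ< y<) ∷ qs , cong (_∷ _) (cong₂ _,_ (Fin.toℕ-fromℕ< x<) (Fin.toℕ-fromℕ< y<))

  -- Coordinates in `ℕ` can be translated and compared by computation; `drawing` ties them to the
  -- bounded points of the grid.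
  record Drawn (ps : List Coords) : Set where
    field
      path    : GridPath c r
      drawing : map coords (points path) ≡ ps

    ∈⇒coords∈ : ∀ {p} → p ∈ᵖ path → coords p ∈ ps
    ∈⇒coords∈ p∈ = subst (_ ∈_) drawing (∈-map⁺ coords p∈)

    ∈⇒point : ∀ {x} → x ∈ ps → ∃[ p ] p ∈ᵖ path × x ≡ coords p
    ∈⇒point x∈ = ∈-map⁻ coords (subst (_ ∈_) (sym drawing) x∈)

    coords∈⇒∈ : ∀ {p} → coords p ∈ ps → p ∈ᵖ path
    coords∈⇒∈ x∈ with q , q∈ , eq ← ∈⇒point x∈ = subst (_∈ᵖ path) (sym (coords-injective eq)) q∈

    consecutive⇒coords∈ : ∀ {p q} → Consecutive p q (points path) → (coords p , coords q) ∈ steps ps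
    consecutive⇒coords∈ pq = subst (λ ps → _ ∈ steps ps) drawing
      (subst (_ ∈_) (sym (steps-map coords (points path))) (∈-map⁺ (Product.map coords coords) (consecutive⇒∈steps pq)))

  open Drawn public

  draw : ∀ {ps} → All InGrid ps → Linked CoordsAdj ps → Unique ps → 2 ≤ length ps → Drawn ps
  draw ins link uniq long with qs , refl ← fromCoords ins = record
    { path = record
      { points     = qs
      ; linked     = Linked.map⁻ link
      ; simple     = Unique.map⁻ uniq
      ; nontrivial = subst (2 ≤_) (length-map coords qs) long
      }
    ; drawing = refl
    }

  meet⇒coords : ∀ {ps qs} (P : Drawn ps) (Q : Drawn qs) →
                (∃[ p ] p ∈ᵖ path P × p ∈ᵖ path Q) → ∃[ x ] x ∈ ps × x ∈ qs
  meet⇒coords P Q (p , p∈P , p∈Q) = coords p , ∈⇒coords∈ P p∈P , ∈⇒coords∈ Q p∈Q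

  coords⇒meet : ∀ {ps qs} (P : Drawn ps) (Q : Drawn qs) {x : Coords} →
                x ∈ ps → x ∈ qs → ∃[ p ] p ∈ᵖ path P × p ∈ᵖ path Q
  coords⇒meet P Q x∈P x∈Q with p , p∈P , refl ← ∈⇒point P x∈P = p , p∈P , coords∈⇒∈ Q x∈Q

-- Grid graphs

_⊕_ : Coords → Coords → Coords
(a , b) ⊕ (x , y) = a + x , b + y

⊕-cancelʳ : ∀ o {p q} → p ⊕ o ≡ q ⊕ o → p ≡ q
⊕-cancelʳ (x , y) {a , b} {a′ , b′} eq =
  cong₂ _,_ (ℕ.+-cancelʳ-≡ x a a′ (cong proj₁ eq)) (ℕ.+-cancelʳ-≡ y b b′ (cong proj₂ eq))

∣a+x-b+x∣≡∣a-b∣ : ∀ a b x → ∣ a + x - b + x ∣ ≡ ∣ a - b ∣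
∣a+x-b+x∣≡∣a-b∣ a b x = trans (cong₂ ∣_-_∣ (ℕ.+-comm a x) (ℕ.+-comm b x)) (ℕ.∣m+n-m+o∣≡∣n-o∣ x a b)

coordsAdj-⊕ : ∀ o {p q} → CoordsAdj p q → CoordsAdj (p ⊕ o) (q ⊕ o)
coordsAdj-⊕ (x , y) {a , b} {a′ , b′} =
  trans (cong₂ (λ m n → m ^ 2 + n ^ 2) (∣a+x-b+x∣≡∣a-b∣ a a′ x) (∣a+x-b+x∣≡∣a-b∣ b b′ y))

-- The first two points of the path of (i , j) lie on the horizontal arms
-- of the paths of (i , j - 1) and (i - 1 , j), respectively; the other
-- three points are the corner and the meeting points with (i , j + 1) and
-- (i + 1 , j).
shape : List Coords
shape = (0 , 0) ∷ (0 , 1) ∷ (0 , 2) ∷ (1 , 2) ∷ (2 , 2) ∷ []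

-- Combinations of the lattice generators (2 , 1) and (1 , 2); the corner of a path is its anchor
-- shifted by (0 , 2).
anchor : ℕ → ℕ → Coords
anchor i j = i * 2 + j , i + j * 2

drawnL : ℕ → ℕ → List Coords
drawnL i j = map (_⊕ anchor i j) shape

shape-linked : Linked CoordsAdj shape
shape-linked = refl ∷ refl ∷ refl ∷ refl ∷ [-]

coords-≟ : (p q : Coords) → Dec (p ≡ q)
coords-≟ = Product.≡-dec ℕ._≟_ ℕ._≟_

shape-unique : Unique shape
shape-unique = ((λ ()) ∷ (λ ()) ∷ (λ ()) ∷ (λ ()) ∷ []) ∷ ((λ ()) ∷ (λ ()) ∷ (λ ()) ∷ []) ∷
               ((λ ()) ∷ (λ ()) ∷ []) ∷ ((λ ()) ∷ []) ∷ [] ∷ []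

-- If p ⊕ anchor i j ≡ q ⊕ anchor i′ j′, then 3 i + dividend p q ≡
-- 3 i′ + dividend q p, and similarly for j with coordinates swapped.
dividend : Coords → Coords → ℕ
dividend (a , b) (a′ , b′) = a * 2 + b′

-- Equal sums have equal residues and quotients by 3. The distance from `i` to `i′` thus depends
-- only on `c` and `c′`, which come from the finite shape.
*3-split : ∀ i i′ c c′ → i * 3 + c ≡ i′ * 3 + c′ → c % 3 ≡ c′ % 3 × ∣ i - i′ ∣ ≡ ∣ c / 3 - c′ / 3 ∣
*3-split i i′ c c′ eq = residue , offset
  where
  residue : c % 3 ≡ c′ % 3
  residue = trans (sym ([m+kn]%n≡m%n c i 3)) (trans (cong (_% 3) (trans (ℕ.+-comm c (i * 3)) (trans eq (ℕ.+-comm (i′ * 3) c′))))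
              ([m+kn]%n≡m%n c′ i′ 3))
  quotient : ∀ i c → (i * 3 + c) / 3 ≡ i + c / 3
  quotient i c = trans (+-distrib-/-∣ˡ c (n∣m*n i)) (cong (_+ c / 3) (m*n/n≡m i 3))
  quotients : i + c / 3 ≡ i′ + c′ / 3
  quotients = trans (sym (quotient i c)) (trans (cong (_/ 3) eq) (quotient i′ c′))
  offset : ∣ i - i′ ∣ ≡ ∣ c / 3 - c′ / 3 ∣
  offset = trans (sym (∣a+x-b+x∣≡∣a-b∣ i i′ (c / 3)))
    (trans (cong (∣_- i′ + c / 3 ∣) quotients)
    (trans (ℕ.∣m+n-m+o∣≡∣n-o∣ i′ (c′ / 3) (c / 3)) (ℕ.∣-∣-comm (c′ / 3) (c / 3))))

-- Twice the first equation minus the second cancels `j` and `j′`. To stay in `ℕ`,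
-- `i + j * 2 + (i′ + j′ * 2)` is added to both sides.
eliminate : ∀ a b a′ b′ i j i′ j′ →
  a + (i * 2 + j) ≡ a′ + (i′ * 2 + j′) → b + (i + j * 2) ≡ b′ + (i′ + j′ * 2) →
  i * 3 + (a * 2 + b′) ≡ i′ * 3 + (a′ * 2 + b)
eliminate a b a′ b′ i j i′ j′ eqₓ eqᵧ = ℕ.+-cancelʳ-≡ (i + j * 2 + (i′ + j′ * 2)) _ _
  (trans (left a b′ i j i′ j′) (trans (cong₂ (λ x y → x * 2 + y) eqₓ (sym eqᵧ)) (right a′ b i j i′ j′)))
  where
  open +-*-Solver
  left : ∀ a b′ i j i′ j′ → i * 3 + (a * 2 + b′) + (i + j * 2 + (i′ + j′ * 2)) ≡
         (a + (i * 2 + j)) * 2 + (b′ + (i′ + j′ * 2))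
  left = solve 6 (λ a b′ i j i′ j′ → i :* con 3 :+ (a :* con 2 :+ b′) :+ (i :+ j :* con 2 :+ (i′ :+ j′ :* con 2)) :=
    (a :+ (i :* con 2 :+ j)) :* con 2 :+ (b′ :+ (i′ :+ j′ :* con 2))) refl
  right : ∀ a′ b i j i′ j′ → (a′ + (i′ * 2 + j′)) * 2 + (b + (i + j * 2)) ≡
          i′ * 3 + (a′ * 2 + b) + (i + j * 2 + (i′ + j′ * 2))
  right = solve 6 (λ a′ b i j i′ j′ → (a′ :+ (i′ :* con 2 :+ j′)) :* con 2 :+ (b :+ (i :+ j :* con 2)) :=
    i′ :* con 3 :+ (a′ :* con 2 :+ b) :+ (i :+ j :* con 2 :+ (i′ :+ j′ :* con 2))) refl

-- Opaque only to keep division by 3 from unfolding on variables.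
opaque

  congruent : Coords → Coords → Set
  congruent p q = dividend p q % 3 ≡ dividend q p % 3 × dividend (swap p) (swap q) % 3 ≡ dividend (swap q) (swap p) % 3

  offsets : Coords → Coords → Coords
  offsets p q = ∣ dividend p q / 3 - dividend q p / 3 ∣ ,
                ∣ dividend (swap p) (swap q) / 3 - dividend (swap q) (swap p) / 3 ∣

  coincide : ∀ p q i j i′ j′ → p ⊕ anchor i j ≡ q ⊕ anchor i′ j′ →
             congruent p q × (∣ i - i′ ∣ , ∣ j - j′ ∣) ≡ offsets p q
  coincide (a , b) (a′ , b′) i j i′ j′ eq =
    both (*3-split i i′ (a * 2 + b′) (a′ * 2 + b) (eliminate a b a′ b′ i j i′ j′ (cong proj₁ eq) (cong proj₂ eq)))
      -- The same elimination with the axes exchanged; the extra rewriting only reorders the sums in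
      -- the anchors.
      (*3-split j j′ (b * 2 + a′) (b′ * 2 + a) (eliminate b a b′ a′ j i j′ i′
        (trans (cong (b +_) (ℕ.+-comm (j * 2) i)) (trans (cong proj₂ eq) (cong (b′ +_) (ℕ.+-comm i′ (j′ * 2)))))
        (trans (cong (a +_) (ℕ.+-comm j (i * 2))) (trans (cong proj₁ eq) (cong (a′ +_) (ℕ.+-comm (i′ * 2) j′))))))
    where
    both : ∀ {A B : Set} {m m′ n n′ : ℕ} → A × m ≡ m′ → B × n ≡ n′ → (A × B) × (m , n) ≡ (m′ , n′)
    both (x , refl) (y , refl) = (x , y) , refl

norm² : Coords → ℕ
norm² (x , y) = x ^ 2 + y ^ 2

shapeEdges : List (Coords × Coords)
shapeEdges = steps shape ++ map swap (steps shape)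

opaque
  unfolding congruent

  congruent? : ∀ p q → Dec (congruent p q)
  congruent? p q = (_ ℕ.≟ _) ×-dec (_ ℕ.≟ _)

  -- Settled by evaluation on the 25 pairs of shape points.
  shape-meetings : All (λ p → All (λ q → congruent p q → offsets p q ≡ (0 , 0) ⊎ norm² (offsets p q) ≡ 1) shape) shape
  shape-meetings = from-yes (all? (λ p → all? (λ q →
    congruent? p q →-dec (coords-≟ (offsets p q) (0 , 0) ⊎-dec (norm² (offsets p q) ℕ.≟ 1))) shape) shape)

  -- Settled by evaluation on the 64 pairs of oriented edges. A common edge of two paths gives the
  -- same offset at both of its ends, whence the last premise.
  shape-edges : All (λ (p , q) → All (λ (p′ , q′) → congruent p p′ → congruent q q′ →
                  offsets p p′ ≡ offsets q q′ → offsets p p′ ≡ (0 , 0)) shapeEdges) shapeEdges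
  shape-edges = from-yes (all? (λ (p , q) → all? (λ (p′ , q′) → congruent? p p′ →-dec (congruent? q q′ →-dec
    (coords-≟ (offsets p p′) (offsets q q′) →-dec coords-≟ (offsets p p′) (0 , 0)))) shapeEdges) shapeEdges)

∈-drawnL : ∀ i j {x} → x ∈ drawnL i j → ∃[ p ] p ∈ shape × x ≡ p ⊕ anchor i j
∈-drawnL i j = ∈-map⁻ (_⊕ anchor i j) {xs = shape}

drawnL-meet : ∀ i j i′ j′ → (∃[ x ] x ∈ drawnL i j × x ∈ drawnL i′ j′) →
              (i , j) ≡ (i′ , j′) ⊎ norm² (∣ i - i′ ∣ , ∣ j - j′ ∣) ≡ 1
drawnL-meet i j i′ j′ (x , x∈ , x∈′)
  with p , p∈ , refl ← ∈-drawnL i j x∈ | q , q∈ , eq ← ∈-drawnL i′ j′ x∈′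
  with cong-pq , Δ≡ ← coincide p q i j i′ j′ eq
  with All.lookup (All.lookup shape-meetings p∈) q∈ cong-pq
... | inj₂ near = inj₂ (trans (cong norm² Δ≡) near)
... | inj₁ none = inj₁ (cong₂ _,_ (ℕ.∣m-n∣≡0⇒m≡n (cong proj₁ (trans Δ≡ none))) (ℕ.∣m-n∣≡0⇒m≡n (cong proj₂ (trans Δ≡ none))))

translate : Coords → Coords × Coords → Coords × Coords
translate o = Product.map (_⊕ o) (_⊕ o)

edgesL : ℕ → ℕ → List (Coords × Coords)
edgesL i j = map (translate (anchor i j)) shapeEdges

∈-edgesL : ∀ i j {e} → e ∈ edgesL i j → ∃[ pq ] pq ∈ shapeEdges × e ≡ translate (anchor i j) pq
∈-edgesL i j = ∈-map⁻ (translate (anchor i j)) {xs = shapeEdges}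

drawnL-edge : ∀ i j i′ j′ {e} → e ∈ edgesL i j → e ∈ edgesL i′ j′ → (i , j) ≡ (i′ , j′)
drawnL-edge i j i′ j′ e∈ e∈′
  with (p , q) , pq∈ , refl ← ∈-edgesL i j e∈ | (p′ , q′) , pq∈′ , eq ← ∈-edgesL i′ j′ e∈′
  with cong-p , Δ≡p ← coincide p p′ i j i′ j′ (cong proj₁ eq) | cong-q , Δ≡q ← coincide q q′ i j i′ j′ (cong proj₂ eq)
  with none ← trans Δ≡p (All.lookup (All.lookup shape-edges pq∈) pq∈′ cong-p cong-q (trans (sym Δ≡p) Δ≡q))
  = cong₂ _,_ (ℕ.∣m-n∣≡0⇒m≡n (cong proj₁ none)) (ℕ.∣m-n∣≡0⇒m≡n (cong proj₂ none))

∣m-n∣≡1 : ∀ m n → ∣ m - n ∣ ≡ 1 → m ≡ suc n ⊎ n ≡ suc m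
∣m-n∣≡1 0       n       eq = inj₂ eq
∣m-n∣≡1 (suc m) 0       eq = inj₁ eq
∣m-n∣≡1 (suc m) (suc n) eq = Sum.map (cong suc) (cong suc) (∣m-n∣≡1 m n eq)

drawnL-right : ∀ i j → ∃[ x ] x ∈ drawnL i j × x ∈ drawnL (suc i) j
-- The generator (2 , 1) takes the second shape point (0 , 1) to the last one, (2 , 2).
drawnL-right i j = _ , there (there (there (there (here refl)))) , there (here refl)

drawnL-up : ∀ i j → ∃[ x ] x ∈ drawnL i j × x ∈ drawnL i (suc j)
drawnL-up i j = _ , there (there (there (here refl))) , here (cong₂ _,_ (sym (ℕ.+-suc (i * 2) j))
  (trans (cong suc (sym (ℕ.+-suc i (j * 2)))) (sym (ℕ.+-suc i (suc (j * 2))))))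

drawnL-near : ∀ i j i′ j′ → norm² (∣ i - i′ ∣ , ∣ j - j′ ∣) ≡ 1 → ∃[ x ] x ∈ drawnL i j × x ∈ drawnL i′ j′
drawnL-near i j i′ j′ near with x²+y²≡1 ∣ i - i′ ∣ ∣ j - j′ ∣ near
... | inj₁ (i≡ , j~) with refl ← ℕ.∣m-n∣≡0⇒m≡n {i} {i′} i≡ with ∣m-n∣≡1 j j′ j~
... | inj₁ refl = Product.map₂ swap (drawnL-up i j′)
... | inj₂ refl = drawnL-up i j
drawnL-near i j i′ j′ near | inj₂ (i~ , j≡) with refl ← ℕ.∣m-n∣≡0⇒m≡n {j} {j′} j≡ with ∣m-n∣≡1 i i′ i~
... | inj₁ refl = Product.map₂ swap (drawnL-right i′ j)
... | inj₂ refl = drawnL-right i j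

drawL : ∀ {a b} (i : Fin a) (j : Fin b) → Drawn {2 + (a * 2 + b)} {2 + (a + b * 2)} (drawnL (toℕ i) (toℕ j))
drawL {a} {b} i j = draw
  (All.map⁺ {f = _⊕ o} (All.map (λ (x≤2 , y≤2) → ℕ.+-mono-≤-< x≤2 x< , ℕ.+-mono-≤-< y≤2 y<) small))
  (Linked.map⁺ {f = _⊕ o} (Linked.map (λ {p} {q} → coordsAdj-⊕ o {p} {q}) shape-linked))
  (Unique.map⁺ (⊕-cancelʳ o) shape-unique)
  (s≤s (s≤s z≤n))
  where
  o = anchor (toℕ i) (toℕ j)
  -- Strictness comes from `j` here and from `i` in `y<`. The 2 in both dimensions of the grid is
  -- the extent of the shape.
  x< : toℕ i * 2 + toℕ j < a * 2 + b
  x< = ℕ.+-mono-≤-< (ℕ.*-monoˡ-≤ 2 (ℕ.<⇒≤ (Fin.toℕ<n i))) (Fin.toℕ<n j)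
  y< : toℕ i + toℕ j * 2 < a + b * 2
  y< = ℕ.+-mono-<-≤ (Fin.toℕ<n i) (ℕ.*-monoˡ-≤ 2 (ℕ.<⇒≤ (Fin.toℕ<n j)))
  small : All (λ (x , y) → x ≤ 2 × y ≤ 2) shape
  small = from-yes (all? (λ (x , y) → (x ℕ.≤? 2) ×-dec (y ℕ.≤? 2)) shape)

gridGraph-vpg : ∀ G → IsGridGraph G → Σ[ R ∈ VPGRepresentation G ] AtMostOnePathPerEdge R
gridGraph-vpg G (a , b , _ , _ , φ , adj⇔) = representation , λ p q _ u v → disjointEdges u v
  where
  col : Vertex G → Fin a
  col = proj₁ ∘ Bijection.to φ

  row : Vertex G → Fin b
  row = proj₂ ∘ Bijection.to φ

  x y : Vertex G → ℕ
  x = toℕ ∘ col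
  y = toℕ ∘ row

  L : ∀ u → Drawn (drawnL (x u) (y u))
  L u = drawL (col u) (row u)

  edge∈ : ∀ u {p q} → EdgeOf (path (L u)) p q → (coords p , coords q) ∈ edgesL (x u) (y u)
  edge∈ u (inj₁ pq) = ∈-++⁺ˡ (consecutive⇒coords∈ (L u) pq)
  edge∈ u (inj₂ qp) = ∈-++⁺ʳ (steps (drawnL (x u) (y u))) (∈-map⁺ swap (consecutive⇒coords∈ (L u) qp))

  same : ∀ u v → (x u , y u) ≡ (x v , y v) → u ≡ v
  same u v eq = Bijection.injective φ (coords-injective eq)

  disjointEdges : ∀ u v {p q} → EdgeOf (path (L u)) p q → EdgeOf (path (L v)) p q → u ≡ v
  disjointEdges u v pq∈u pq∈v = same u v (drawnL-edge (x u) (y u) (x v) (y v) (edge∈ u pq∈u) (edge∈ v pq∈v))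

  representation : VPGRepresentation G
  representation = record
    { columns    = 2 + (a * 2 + b)
    ; rows       = 2 + (a + b * 2)
    ; path       = λ u → path (L u)
    -- Every path has an edge, so paths without common edges are distinct.
    ; injective  = λ u v same →
        let p , q , pq∈u , pq∈v = samePath⇒commonEdge (path (L u)) (path (L v)) same
        in disjointEdges u v pq∈u pq∈v
    ; represents = λ u v u≢v → mk⇔
        (λ adj → let _ , x∈u , x∈v = drawnL-near (x u) (y u) (x v) (y v) (Equivalence.to (adj⇔ u v) adj)
                 in coords⇒meet (L u) (L v) x∈u x∈v)
        (λ meet → [ (λ eq → contradiction (same u v eq) u≢v) , Equivalence.from (adj⇔ u v) ]′
                    (drawnL-meet (x u) (y u) (x v) (y v) (meet⇒coords (L u) (L v) meet)))
    }

-- Split graphs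

Block : ℕ → Coords → Set
Block i p = p ≡ (1 , i * 2) ⊎ p ≡ (1 , suc (i * 2))

block-injective : ∀ {i i′ p} → Block i p → Block i′ p → i ≡ i′
block-injective {i} {i′} b b′ = trans (sym (half b)) (half b′)
  where
  even : ∀ i → ⌊ i * 2 /2⌋ ≡ i
  even zero    = refl
  even (suc i) = cong suc (even i)
  odd : ∀ i → ⌊ suc (i * 2) /2⌋ ≡ i
  odd zero    = refl
  odd (suc i) = cong suc (odd i)
  half : ∀ {i p} → Block i p → ⌊ proj₂ p /2⌋ ≡ i
  half {i} (inj₁ refl) = even i
  half {i} (inj₂ refl) = odd i

up2 : Coords → Coords
up2 (x , y) = x , 2 + y

detour : Bool → List Coords → List Coords
detour true  rest = (1 , 0) ∷ (1 , 1) ∷ (0 , 1) ∷ rest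
detour false rest = (0 , 1) ∷ rest

-- Column 0 with a detour to column 1 along Block i for each i with d i ≡ true.
trail : ∀ {n} → (Fin n → Bool) → List Coords
trail {zero}  d = []
trail {suc n} d = (0 , 0) ∷ detour (d Fin.zero) (map up2 (trail (d ∘ Fin.suc)))

trail-long : ∀ {n} → Fin n → (d : Fin n → Bool) → 2 ≤ length (trail d)
trail-long {suc n} _ d with d Fin.zero
... | true  = s≤s (s≤s z≤n)
... | false = s≤s (s≤s z≤n)

trail-origin : ∀ {n} → Fin n → (d : Fin n → Bool) → (0 , 0) ∈ trail d
trail-origin {suc n} _ d = here refl

detour-All : ∀ {P : Coords → Set} b {rest} → (∀ x y → x < 2 → y < 2 → P (x , y)) → All P rest → All P (detour b rest)
detour-All true  small ps = small 1 0 (s≤s (s≤s z≤n)) (s≤s z≤n) ∷ small 1 1 (s≤s (s≤s z≤n)) (s≤s (s≤s z≤n)) ∷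
                            small 0 1 (s≤s z≤n) (s≤s (s≤s z≤n)) ∷ ps
detour-All false small ps = small 0 1 (s≤s z≤n) (s≤s (s≤s z≤n)) ∷ ps

trail-inGrid : ∀ {n} (d : Fin n → Bool) → All (λ (x , y) → x < 2 × y < n * 2) (trail d)
trail-inGrid {zero}  d = []
trail-inGrid {suc n} d = (s≤s z≤n , s≤s z≤n) ∷ detour-All (d Fin.zero)
  (λ _ _ x<2 y<2 → x<2 , ℕ.≤-trans y<2 (s≤s (s≤s z≤n)))
  (All.map⁺ (All.map (λ (x<2 , y<) → x<2 , s≤s (s≤s y<)) (trail-inGrid (d ∘ Fin.suc))))

mutual
  trail-linked : ∀ {n} (d : Fin n → Bool) → Linked CoordsAdj (trail d)
  trail-linked {zero}  d = []
  trail-linked {suc n} d with d Fin.zero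
  ... | true  = refl ∷ refl ∷ refl ∷ trail-continues (d ∘ Fin.suc)
  ... | false = refl ∷ trail-continues (d ∘ Fin.suc)

  -- Either form of a detour ends in (0 , 1), where the shifted rest of the trail is attached.
  trail-continues : ∀ {n} (d : Fin n → Bool) → Linked CoordsAdj ((0 , 1) ∷ map up2 (trail d))
  trail-continues {zero}  d = [-]
  trail-continues {suc n} d = refl ∷ Linked.map⁺ (trail-linked d)

up2-injective : ∀ {p q} → up2 p ≡ up2 q → p ≡ q
up2-injective refl = refl

trail-unique : ∀ {n} (d : Fin n → Bool) → Unique (trail d)
trail-unique {zero}  d = []
trail-unique {suc n} d = add (d Fin.zero) (Unique.map⁺ up2-injective (trail-unique (d ∘ Fin.suc)))
  where
  fresh : ∀ {x y} ps → y < 2 → All ((x , y) ≢_) (map up2 ps)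
  fresh ps y<2 = All.map⁺ (All.universal (λ { _ refl → contradiction y<2 λ { (s≤s (s≤s ())) } }) ps)
  add : ∀ b {ps} → Unique (map up2 ps) → Unique ((0 , 0) ∷ detour b (map up2 ps))
  add true  {ps} uniq =
    ((λ ()) ∷ (λ ()) ∷ (λ ()) ∷ fresh ps (s≤s z≤n)) ∷ ((λ ()) ∷ (λ ()) ∷ fresh ps (s≤s z≤n)) ∷
    ((λ ()) ∷ fresh ps (s≤s (s≤s z≤n))) ∷ fresh ps (s≤s (s≤s z≤n)) ∷ uniq
  add false {ps} uniq = ((λ ()) ∷ fresh ps (s≤s z≤n)) ∷ fresh ps (s≤s (s≤s z≤n)) ∷ uniq

∈-detour : ∀ {p} b {rest} → p ∈ rest → p ∈ detour b rest
∈-detour true  p∈ = there (there (there p∈))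
∈-detour false p∈ = there p∈

trail-block⁺ : ∀ {n} (d : Fin n → Bool) i → d i ≡ true → (1 , toℕ i * 2) ∈ trail d
trail-block⁺ d Fin.zero    on rewrite on = there (here refl)
trail-block⁺ d (Fin.suc i) on =
  there (∈-detour (d Fin.zero) (∈-map⁺ up2 (trail-block⁺ (d ∘ Fin.suc) i on)))

-- Column 1 is entered by detours only; a later one is found in the rest of the trail and shifted by
-- `up2`.
trail-block⁻ : ∀ {n} (d : Fin n → Bool) {y} → (1 , y) ∈ trail d → ∃[ i ] d i ≡ true × Block (toℕ i) (1 , y)
trail-block⁻ {suc n} d (there p∈) = split (d Fin.zero) refl p∈
  where
  later : ∀ {y} → (1 , y) ∈ map up2 (trail (d ∘ Fin.suc)) → ∃[ i ] d i ≡ true × Block (toℕ i) (1 , y)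
  later p∈ with _ , q∈ , refl ← ∈-map⁻ up2 p∈ with i , dᵢ , b ← trail-block⁻ (d ∘ Fin.suc) q∈ =
    Fin.suc i , dᵢ , Sum.map (cong up2) (cong up2) b
  split : ∀ b → d Fin.zero ≡ b → ∀ {y} → (1 , y) ∈ detour b (map up2 (trail (d ∘ Fin.suc))) →
          ∃[ i ] d i ≡ true × Block (toℕ i) (1 , y)
  split true  d₀ (here refl)                = Fin.zero , d₀ , inj₁ refl
  split true  d₀ (there (here refl))        = Fin.zero , d₀ , inj₂ refl
  split true  d₀ (there (there (there p∈))) = later p∈
  split false d₀ (there p∈)                 = later p∈

module _ (G : Graph) (split : IsSplitGraph G) where
  open Graph G using (order; Adj; adj?)

  K           = proj₁ split
  clique      = proj₁ (proj₂ split)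
  independent = proj₂ (proj₂ split)

  -- Visiting the own block serves to make the paths of twins distinct.
  Visits : Vertex G → Vertex G → Set
  Visits u v = u ≡ v ⊎ (v ∉ₛ K × Adj u v)

  visits? : ∀ u v → Dec (Visits u v)
  visits? u v = (u Fin.≟ v) ⊎-dec (¬? (v ∈ₛ? K) ×-dec adj? u v)

  tour : Vertex G → Vertex G → Bool
  tour u v = does (visits? u v)

  drawnPoints : ∀ u → Dec (u ∈ₛ K) → List Coords
  drawnPoints u (yes _) = trail (tour u)
  drawnPoints u (no _)  = (1 , toℕ u * 2) ∷ (1 , suc (toℕ u * 2)) ∷ []

  pointsOf : Vertex G → List Coords
  pointsOf u = drawnPoints u (u ∈ₛ? K)

  drawVertex : ∀ u → Drawn {2} {order * 2} (pointsOf u)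
  drawVertex u with u ∈ₛ? K
  ... | yes _ = draw (trail-inGrid (tour u)) (trail-linked (tour u)) (trail-unique (tour u)) (trail-long u (tour u))
  ... | no  _ = draw ((ℕ.≤-refl , ℕ.≤-trans (ℕ.n≤1+n _) row) ∷ (ℕ.≤-refl , row) ∷ [])
                  (vertical (toℕ u * 2) ∷ [-]) (((λ eq → ℕ.1+n≢n (sym (cong proj₂ eq))) ∷ []) ∷ [] ∷ []) ℕ.≤-refl
    where
    row : suc (suc (toℕ u * 2)) ≤ order * 2
    row = ℕ.*-monoˡ-≤ 2 (Fin.toℕ<n u)
    vertical : ∀ y → CoordsAdj (1 , y) (1 , suc y)
    vertical zero    = refl
    vertical (suc y) = vertical y

  own-block : ∀ u → (1 , toℕ u * 2) ∈ pointsOf u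
  own-block u with u ∈ₛ? K
  ... | yes _ = trail-block⁺ (tour u) u (dec-true (visits? u u) (inj₁ refl))
  ... | no  _ = here refl

  block⁺ : ∀ {u v} → u ∈ₛ K → v ∉ₛ K → Adj u v → (1 , toℕ v * 2) ∈ pointsOf u
  block⁺ {u} {v} u∈ v∉ uv with u ∈ₛ? K
  ... | yes _ = trail-block⁺ (tour u) v (dec-true (visits? u v) (inj₂ (v∉ , uv)))
  ... | no u∉ = contradiction u∈ u∉

  origin : ∀ {u} → u ∈ₛ K → (0 , 0) ∈ pointsOf u
  origin {u} u∈ with u ∈ₛ? K
  ... | yes _ = trail-origin u (tour u)
  ... | no u∉ = contradiction u∈ u∉

  independent-block : ∀ {u p} → u ∉ₛ K → p ∈ pointsOf u → Block (toℕ u) p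
  independent-block {u} u∉ p∈ with u ∈ₛ? K
  ... | yes u∈ = contradiction u∈ u∉
  independent-block u∉ (here eq)         | no _ = inj₁ eq
  independent-block u∉ (there (here eq)) | no _ = inj₂ eq

  -- The path of an independent vertex stays in its own block, and a trail meets column 1 only in
  -- the blocks that it visits.
  block⁻ : ∀ {u v p} → Block (toℕ v) p → p ∈ pointsOf u → u ≡ v ⊎ (u ∈ₛ K × v ∉ₛ K × Adj u v)
  block⁻ {u} {v} b p∈ with u ∈ₛ? K
  ... | yes u∈ = visit b p∈
    where
    visits : ∀ {i} → tour u i ≡ true → Visits u i
    visits {i} on = decidable-stable (visits? u i) λ ¬visits →
      contradiction (trans (sym on) (dec-false (visits? u i) ¬visits)) λ ()
    found : ∀ {y} → Block (toℕ v) (1 , y) → (1 , y) ∈ trail (tour u) → Visits u v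
    found b p∈ with i , on , b′ ← trail-block⁻ (tour u) p∈
      = subst (Visits u) (Fin.toℕ-injective (block-injective b′ b)) (visits on)
    visit : ∀ {p} → Block (toℕ v) p → p ∈ trail (tour u) → u ≡ v ⊎ (u ∈ₛ K × v ∉ₛ K × Adj u v)
    visit b@(inj₁ refl) p∈ = Sum.map₂ (u∈ ,_) (found b p∈)
    visit b@(inj₂ refl) p∈ = Sum.map₂ (u∈ ,_) (found b p∈)
  block⁻ b (here eq)         | no _ = inj₁ (Fin.toℕ-injective (block-injective (inj₁ eq) b))
  block⁻ b (there (here eq)) | no _ = inj₁ (Fin.toℕ-injective (block-injective (inj₂ eq) b))

  adjacent⇒meet : ∀ {u v} → Adj u v → ∃[ x ] x ∈ pointsOf u × x ∈ pointsOf v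
  adjacent⇒meet {u} {v} uv = meet (u ∈ₛ? K) (v ∈ₛ? K)
    where
    meet : Dec (u ∈ₛ K) → Dec (v ∈ₛ K) → ∃[ x ] x ∈ pointsOf u × x ∈ pointsOf v
    -- All clique paths start at the origin.
    meet (yes u∈) (yes v∈) = (0 , 0) , origin u∈ , origin v∈
    meet (yes u∈) (no  v∉) = (1 , toℕ v * 2) , block⁺ u∈ v∉ uv , own-block v
    meet (no  u∉) (yes v∈) = (1 , toℕ u * 2) , own-block u , block⁺ v∈ u∉ (Graph.sym G uv)
    meet (no  u∉) (no  v∉) = contradiction uv (independent u v u∉ v∉)

  meet⇒adjacent : ∀ {u v} → u ≢ v → (∃[ x ] x ∈ pointsOf u × x ∈ pointsOf v) → Adj u v
  meet⇒adjacent {u} {v} u≢v (x , x∈u , x∈v) = adjacent (u ∈ₛ? K) (v ∈ₛ? K)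
    where
    adjacent : Dec (u ∈ₛ K) → Dec (v ∈ₛ K) → Adj u v
    adjacent (yes u∈) (yes v∈) = clique u v u∈ v∈ u≢v
    -- The path of the independent vertex `v` is its block, so the common point shows that `u`
    -- enters this block.
    adjacent _ (no v∉) with block⁻ (independent-block v∉ x∈v) x∈u
    ... | inj₁ u≡v          = contradiction u≡v u≢v
    ... | inj₂ (_ , _ , uv) = uv
    adjacent (no u∉) (yes _) with block⁻ (independent-block u∉ x∈u) x∈v
    ... | inj₁ v≡u          = contradiction (sym v≡u) u≢v
    ... | inj₂ (_ , _ , vu) = Graph.sym G vu

  samePath⇒pointsOf⊆ : ∀ u v → SamePath (path (drawVertex u)) (path (drawVertex v)) →
                       ∀ {x} → x ∈ pointsOf u → x ∈ pointsOf v
  samePath⇒pointsOf⊆ u v same x∈ with p , p∈ , refl ← ∈⇒point (drawVertex u) x∈ =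
    ∈⇒coords∈ (drawVertex v) (samePath⇒∈ {P = path (drawVertex u)} {path (drawVertex v)} same p∈)

  -- Each path contains a point of its own block. If `u` and `v` differed, equal paths would make
  -- `u` independent by one block and a clique vertex by the other.
  drawVertex-injective : ∀ u v → SamePath (path (drawVertex u)) (path (drawVertex v)) → u ≡ v
  drawVertex-injective u v same
    with block⁻ (inj₁ refl) (samePath⇒pointsOf⊆ u v same (own-block u))
       | block⁻ (inj₁ refl) (samePath⇒pointsOf⊆ v u (λ p q → ⇔-sym (same p q)) (own-block v))
  ... | inj₁ v≡u          | _                 = sym v≡u
  ... | _                 | inj₁ u≡v          = u≡v
  ... | inj₂ (_ , u∉ , _) | inj₂ (u∈ , _ , _) = contradiction u∈ u∉

splitGraph-vpg : ∀ G → IsSplitGraph G → Σ[ R ∈ VPGRepresentation G ] VPGRepresentation.columns R ≤ 4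
-- The paths are drawn in columns 0 and 1, so the bound reads 2 ≤ 4.
splitGraph-vpg G split = representation , s≤s (s≤s z≤n)
  where
  representation : VPGRepresentation G
  representation = record
    { path       = λ u → path (drawVertex G split u)
    ; injective  = drawVertex-injective G split
    ; represents = λ u v u≢v → mk⇔
        (λ uv → let x , x∈u , x∈v = adjacent⇒meet G split uv
                in coords⇒meet (drawVertex G split u) (drawVertex G split v) x∈u x∈v)
        (λ meet → meet⇒adjacent G split u≢v (meet⇒coords (drawVertex G split u) (drawVertex G split v) meet))
    }

mainTheorem7 : ((∀ G → IsGridGraph G → Σ[ R ∈ VPGRepresentation G ] AtMostOnePathPerEdge R)
    × ¬ BoundedMimWidth IsGridGraph)
    ×
    ((∀ G → IsSplitGraph G → Σ[ R ∈ VPGRepresentation G ] VPGRepresentation.columns R ≤ 4)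
    × ¬ BoundedMimWidth IsSplitGraph)
mainTheorem7 = (gridGraph-vpg , gridGraphs-unbounded) , (splitGraph-vpg , splitGraphs-unbounded)
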